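{- Fix a positive natural number $\ell$. The theory $\mathcal{T_M}^+$ (defined in the context) proves the following mathematical statement. Let $U_0,\ldots,U_{\ell-1}$ be mappings from $X$ to $X$, $\varphi_0,\ldots,\varphi_{\ell-1}$ mappings from $X\times X$ to $\mathbb{R}$, and $(u_n)_{n\in\mathbb{N}}$ a sequence of elements of $X$ such that $\lim_nd(U_i(u_n),u_n)=0$ for all $i<\ell$. Let $F:=\bigcap_{i=0}^{\ell-1}Fix(U_i)$. Assume that $$\forall k\in\mathbb{N}\,\exists x\in F\,\forall y\in F\,\forall i<\ell\left(\varphi_i(x,x)<\varphi_i(x,y)+\frac{1}{k+1}\right).$$ Then $$\forall k\in\mathbb{N}\,\exists x\in F\,\exists n\in\mathbb{N}\,\forall m\geq n\,\forall i<\ell\left(\varphi_i(x,x)<\varphi_i(x,u_m)+\frac{1}{k+1}\right).$$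
   Context: **The theory $\mathcal{T_M}$** (bounded metric spaces). Language: finite types over base types $0$ (natural numbers) and $X$ (abstract metric space); $1:=0\to0$; classical many-sorted logic; the only primitive relation is $=_0$. Constants: combinators; zero, successor, recursors for G\"odel's primitive recursive functionals (all types); $d$ of type $X\to(X\to1)$; $b$ of type $0$ (a positive bound on the diameter of $X$). Reals are represented by type-$1$ functionals in signed digit representation: to each $\gamma^1$ is associated primitive recursively (in the sense of Kleene) a representation $\gamma_{\mathbb{R}}$ of a real; $=_{\mathbb{R}},\leq_{\mathbb{R}}$ are $\Pi^0_1$ and $<_{\mathbb{R}}$ is $\Sigma^0_1$. $\gamma_{[0,1]}:=\max_{\mathbb{R}}(0_{\mathbb{R}},\min_{\mathbb{R}}(1_{\mathbb{R}},\gamma_{\mathbb{R}}))$, with a fixed $l^1$ such that $\gamma_{[0,1]}(n)\leq l(n)$ always; $\forall\gamma\in[0,1](\ldots\gamma\ldots)$ stands for $\forall\gamma^1(\ldots\gamma_{[0,1]}\ldots)$, dually for $\exists$. $x=_Xy$ abbreviates $d(x,y)=_{\mathbb{R}}0_{\mathbb{R}}$. Axioms: the usual axioms for combinators and arithmetic constants (full induction scheme); Spector's weak (quantifier-free) extensionality rule; $\forall x^X,y^X\forall n^0(d(x,y)(n)=_0d(x,y)_{\mathbb{R}}(n))$; $d(x,x)=_{\mathbb{R}}0_{\mathbb{R}}$; $d(x,y)=_{\mathbb{R}}d(y,x)$; $d(x,z)\leq_{\mathbb{R}}d(x,y)+d(y,z)$; $d(x,y)\leq_{\mathbb{R}}b_{\mathbb{R}}$.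 **The theory $\mathcal{T_M}^+$.** Bounded formulas are built from atomic formulas by propositional connectives and the bounded quantifications $\forall k\leq_0n$, $\exists k\leq_0n$, $\forall x^X$, $\exists x^X$, $\forall\gamma\in[0,1]$, $\exists\gamma\in[0,1]$. A $\Sigma$-formula has the form $\exists n^0B(n)$ with $B$ bounded. For $f$ of type $1$, $\tilde f(n):=\max_{k\leq n}f(k)$. $\mathcal{T_M}^+$ is $\mathcal{T_M}$ plus, for all $\Sigma$-formulas $A$ (possibly with parameters): bounded choice $\forall n^0\exists k^0A(n,k)\to\exists f^1\forall n\exists k\leq\tilde f(n)A(n,k)$; and bounded collection $\forall i\leq_0m\exists n^0A(i,n)\to\exists n\forall i\leq m\exists k\leq nA(i,k)$, $\forall\gamma\in[0,1]\exists n^0A(\gamma,n)\to\exists n\forall\gamma\in[0,1]\exists k\leq nA(\gamma,k)$, $\forall x^X\exists n^0A(x,n)\to\exists n\forall x^X\exists k\leq nA(x,k)$. The mathematical statement is understood as formalized in this language: the $U_i$ are variables of type $X\to X$, $(u_n)$ of type $0\to X$, the $\varphi_i$ of type $X\to(X\to1)$ (real-valued via representations); since $\ell$ is a fixed numeral, "$\forall i<\ell$" stands for a finite conjunction; $x\in Fix(U_i)$ means $U_i(x)=_Xx$; $\lim_nd(U_i(u_n),u_n)=0$ means $\forall r\exists n\forall m\geq n\,(d(U_i(u_m),u_m)\leq\frac{1}{r+1})$; no extensionality or continuity is assumed. -}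

module Defs where

open import Data.Fin using (Fin; zero; suc)
open import Data.List using (List; []; _∷_; _++_; map; replicate)
open import Data.List.Membership.Propositional using (_∈_)
open import Data.List.Membership.Propositional.Properties using (∈-++⁺ˡ; ∈-++⁺ʳ)
open import Data.List.Relation.Binary.Subset.Propositional using (_⊆_)
open import Data.List.Relation.Binary.Subset.Propositional.Properties using (∷⁺ʳ)
open import Data.List.Relation.Unary.Any using (here; there)
open import Data.Nat using (ℕ; zero; suc)
open import Relation.Binary.PropositionalEquality using (refl)

------------------------------------------------------------------------
-- Types and terms

infixr 7 _⟶_

data Ty : Set where
  O X : Ty
  _⟶_ : Ty → Ty → Ty

𝟏 : Ty
𝟏 = O ⟶ O

Cx : Set
Cx = List Ty

variable
  ρ σ τ : Ty
  Γ Θ : Cx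

data Con : Ty → Set where
  𝐊 : Con (σ ⟶ τ ⟶ σ)
  𝐒 : Con ((ρ ⟶ σ ⟶ τ) ⟶ (ρ ⟶ σ) ⟶ ρ ⟶ τ)
  𝟘 : Con O
  𝐬 : Con (O ⟶ O)
  𝐑 : Con (O ⟶ ρ ⟶ (ρ ⟶ O ⟶ ρ) ⟶ ρ)
  𝐝 : Con (X ⟶ X ⟶ 𝟏)
  𝐛 : Con O

infixl 9 _·_
infixl 10 _↑

-- De Bruijn variables: a variable of type σ is a position of σ in the
-- context, the most recently bound one being at the head.
data Tm (Γ : Cx) : Ty → Set where
  var : σ ∈ Γ → Tm Γ σ
  con : Con σ → Tm Γ σ
  _·_ : Tm Γ (σ ⟶ τ) → Tm Γ σ → Tm Γ τ

ren : Γ ⊆ Θ → Tm Γ σ → Tm Θ σ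
ren r (var x) = var (r x)
ren r (con c) = con c
ren r (s · t) = ren r s · ren r t

_↑ : Tm Γ σ → Tm (ρ ∷ Γ) σ
t ↑ = ren there t

Sub : Cx → Cx → Set
Sub Γ Θ = ∀ {σ} → σ ∈ Γ → Tm Θ σ

lift : Sub Γ Θ → Sub (ρ ∷ Γ) (ρ ∷ Θ)
lift f (here refl) = var (here refl)
lift f (there x)   = f x ↑

sub : Sub Γ Θ → Tm Γ σ → Tm Θ σ
sub f (var x) = f x
sub f (con c) = con c
sub f (s · t) = sub f s · sub f t

-- Replace the head variable by t, ...
inst : Tm Γ σ → Sub (σ ∷ Γ) Γ
inst t (here refl) = t
inst t (there x)   = var x

-- ... or by a term t that itself has a head variable, of type τ.
inst⁺ : Tm (τ ∷ Γ) σ → Sub (σ ∷ Γ) (τ ∷ Γ)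
inst⁺ t (here refl) = t
inst⁺ t (there x)   = var (there x)

infix 10 _[_]ᵗ

_[_]ᵗ : Tm (σ ∷ Γ) τ → Tm Γ σ → Tm Γ τ
r [ t ]ᵗ = sub (inst t) r

v₀ : Tm (σ ∷ Γ) σ
v₀ = var (here refl)

v₁ : Tm (ρ ∷ σ ∷ Γ) σ
v₁ = v₀ ↑

v₂ : Tm (ρ ∷ τ ∷ σ ∷ Γ) σ
v₂ = v₁ ↑

-- The language has combinators only; ƛ is bracket abstraction.  The three
-- results of `abstr t` say that the abstracted variable does not occur in t,
-- that t is that variable, or give the abstraction (with η: λx. s x is s).
data Abstr (Γ : Cx) : Ty → Ty → Set where
  const : Tm Γ τ → Abstr Γ σ τ
  ident : Abstr Γ σ σ
  fun   : Tm Γ (σ ⟶ τ) → Abstr Γ σ τ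

toFun : Abstr Γ σ τ → Tm Γ (σ ⟶ τ)
toFun (const t)       = con 𝐊 · t
toFun (ident {σ = σ}) = con 𝐒 · con 𝐊 · con (𝐊 {τ = σ})
toFun (fun t)         = t

abstr-app : Abstr Γ ρ (σ ⟶ τ) → Abstr Γ ρ σ → Abstr Γ ρ τ
abstr-app (const s) (const t) = const (s · t)
abstr-app (const s) ident     = fun s
abstr-app s         t         = fun (con 𝐒 · toFun s · toFun t)

abstr : Tm (σ ∷ Γ) τ → Abstr Γ σ τ
abstr (var (here refl)) = ident
abstr (var (there x))   = const (var x)
abstr (con c)           = const (con c)
abstr (s · t)           = abstr-app (abstr s) (abstr t)

infixr 0 ƛ_

ƛ_ : Tm (σ ∷ Γ) τ → Tm Γ (σ ⟶ τ)
ƛ t = toFun (abstr t)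

------------------------------------------------------------------------
-- Primitive recursive arithmetic

𝐬· : Tm Γ O → Tm Γ O
𝐬· t = con 𝐬 · t

rec : Tm Γ O → Tm Γ ρ → Tm Γ (ρ ⟶ O ⟶ ρ) → Tm Γ ρ
rec n y z = con 𝐑 · n · y · z

num : ℕ → Tm Γ O
num zero    = con 𝟘
num (suc n) = 𝐬· (num n)

plus monus times : Tm Γ (O ⟶ O ⟶ O)
pred : Tm Γ 𝟏
pred  = ƛ rec v₀ (num 0) (ƛ ƛ v₀)
plus  = ƛ ƛ rec v₀ v₁ (ƛ ƛ 𝐬· v₁)
monus = ƛ ƛ rec v₀ v₁ (ƛ ƛ pred · v₁)
times = ƛ ƛ rec v₀ (num 0) (ƛ ƛ plus · v₁ · (v₁ ↑ ↑))

infixl 7 _∗_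
infixl 6 _∔_ _∸̇_

_∔_ _∸̇_ _∗_ : Tm Γ O → Tm Γ O → Tm Γ O
s ∔ t = plus · s · t
s ∸̇ t = monus · s · t
s ∗ t = times · s · t

-- Characteristic function of ≤ (value 1 for true).
le : Tm Γ (O ⟶ O ⟶ O)
le = ƛ ƛ num 1 ∸̇ (v₁ ∸̇ v₀)

min₀ max₀ : Tm Γ (O ⟶ O ⟶ O)
min₀ = ƛ ƛ v₁ ∸̇ (v₁ ∸̇ v₀)
max₀ = ƛ ƛ v₁ ∔ (v₀ ∸̇ v₁)

pow2 : Tm Γ 𝟏
pow2 = ƛ rec v₀ (num 1) (ƛ ƛ v₁ ∔ v₁)

-- quot · m · k = ⌊ m / (k + 1) ⌋
quot : Tm Γ (O ⟶ O ⟶ O)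
quot = ƛ ƛ rec v₁ (num 0)
             (ƛ ƛ v₁ ∔ le · (𝐬· (v₀ ↑ ↑) ∗ 𝐬· v₁) · 𝐬· v₀)

-- f̃(n) = max of f(k) over k ≤ n
tilde : Tm Γ (𝟏 ⟶ 𝟏)
tilde = ƛ ƛ rec v₀ (v₁ · num 0) (ƛ ƛ max₀ · v₁ · (v₁ ↑ ↑ · 𝐬· v₀))

-- seq · a · b · f is the sequence a, b, f(0), f(1), ...
seq : Tm Γ (O ⟶ O ⟶ 𝟏 ⟶ 𝟏)
seq = ƛ ƛ ƛ ƛ rec v₀ (v₂ ↑)
                  (ƛ ƛ rec v₀ (v₂ ↑ ↑) (ƛ ƛ v₁ ↑ ↑ ↑ ↑ · v₀))

------------------------------------------------------------------------
-- Real numbers in signed digit representation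
--
-- γ represents  γ(0) − γ(1) + Σᵢ (min(γ(i+2),2) − 1) / 2^(i+1) :
-- a difference of naturals for the integer part, then digits −1, 0, 1
-- written as 0, 1, 2.

-- γ ↦ γ_ℝ
nrm : Tm Γ (𝟏 ⟶ 𝟏)
nrm = ƛ seq · (v₀ · num 0) · (v₀ · num 1) · (ƛ min₀ · (v₁ · 𝐬· (𝐬· v₀)) · num 2)

-- The n-th partial sum of γ_ℝ, which is within 2⁻ⁿ of the real, is
-- (pos γ n − neg γ n) / 2ⁿ.  The digit −1 hidden in each e − 1 is
-- accumulated in neg.
pos neg : Tm Γ (𝟏 ⟶ 𝟏)
pos = ƛ partial · (nrm · v₀)
  where
  partial : Tm Γ (𝟏 ⟶ 𝟏)
  partial = ƛ ƛ rec v₀ (v₁ · num 0) (ƛ ƛ num 2 ∗ v₁ ∔ v₁ ↑ ↑ · 𝐬· (𝐬· v₀))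
neg = ƛ ƛ rec v₀ (nrm · v₁ · num 1) (ƛ ƛ 𝐬· (num 2 ∗ v₁))

-- Given p, q with |2ⁿ x − (p(n) − q(n))| ≤ 2 for all n, `norm · p · q` is
-- a representation of x.  Its n-th partial sum Aₙ / 2ⁿ satisfies
-- |2ⁿ x − Aₙ| ≤ 1, where Aₙ = Tₙ + (eₙ − 1), T₀ = p(0) − q(0),
-- Tₙ₊₁ = 2 Aₙ, and the digit eₙ ∈ {0, 1, 2} is chosen by comparing
-- p(n+3) − q(n+3) − 8 Tₙ with ±4.  Below, Tₙ = T⁺(n) − T⁻(n).

-- Position of a − c relative to −4 and 4.
digit : Tm Γ (O ⟶ O ⟶ O)
digit = ƛ ƛ le · (v₀ ∔ num 4) · v₁ ∔ le · v₀ · (v₁ ∔ num 4)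

T⁻ : Tm Γ (𝟏 ⟶ 𝟏)
T⁻ = ƛ ƛ rec v₀ (v₁ · num 0) (ƛ ƛ num 2 ∗ 𝐬· v₁)

nextDigit : (p q : Tm Γ 𝟏) (n s t : Tm Γ O) → Tm Γ O
nextDigit p q n s t =
  digit · (p · (n ∔ num 3) ∔ num 8 ∗ t) · (q · (n ∔ num 3) ∔ num 8 ∗ s)

T⁺ : Tm Γ (𝟏 ⟶ 𝟏 ⟶ 𝟏)
T⁺ = ƛ ƛ ƛ rec v₀ (v₂ · num 0)
  (ƛ ƛ num 2 ∗ (v₁ ∔ nextDigit (v₂ ↑ ↑) (v₁ ↑ ↑) v₀ v₁ (T⁻ · (v₁ ↑ ↑) · v₀)))

digits : Tm Γ (𝟏 ⟶ 𝟏 ⟶ 𝟏)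
digits = ƛ ƛ ƛ nextDigit v₂ v₁ v₀ (T⁺ · v₂ · v₁ · v₀) (T⁻ · v₁ · v₀)

norm : Tm Γ (𝟏 ⟶ 𝟏 ⟶ 𝟏)
norm = ƛ ƛ assemble · (v₁ · num 0) · 𝐬· (v₀ · num 0) · (digits · v₁ · v₀)
  where
  -- p(0), q(0) + 1 and the digits e; the integer part is
  -- A₀ = p(0) + e(0) − (q(0) + 1).
  assemble : Tm Γ (O ⟶ O ⟶ 𝟏 ⟶ 𝟏)
  assemble = ƛ ƛ ƛ seq · (v₂ ∔ v₀ · num 0 ∸̇ v₁) · (v₁ ∸̇ (v₂ ∔ v₀ · num 0))
                       · (ƛ v₁ · 𝐬· v₀)

-- In lat · f · p · q · p′ · q′, the integers p − q and p′ − q′ are brought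
-- to the common subtrahend q + q′ before f is applied.
sum : Tm Γ (𝟏 ⟶ 𝟏 ⟶ 𝟏)
sum = ƛ ƛ ƛ v₂ · v₀ ∔ v₁ · v₀

lat : Tm Γ ((O ⟶ O ⟶ O) ⟶ 𝟏 ⟶ 𝟏 ⟶ 𝟏 ⟶ 𝟏 ⟶ 𝟏)
lat = ƛ ƛ ƛ ƛ ƛ norm
  · (ƛ v₂ ↑ ↑ ↑ · (v₂ ↑ ↑ · v₀ ∔ v₁ · v₀) · (v₂ · v₀ ∔ v₂ ↑ · v₀))
  · (sum · v₂ · v₀)

addᵣ maxᵣ minᵣ : Tm Γ (𝟏 ⟶ 𝟏 ⟶ 𝟏)
addᵣ = ƛ ƛ norm · (sum · (pos · v₁) · (pos · v₀))
                · (sum · (neg · v₁) · (neg · v₀))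
maxᵣ = ƛ ƛ lat · max₀ · (pos · v₁) · (neg · v₁) · (pos · v₀) · (neg · v₀)
minᵣ = ƛ ƛ lat · min₀ · (pos · v₁) · (neg · v₁) · (pos · v₀) · (neg · v₀)

natᵣ : Tm Γ (O ⟶ 𝟏)
natᵣ = ƛ seq · v₀ · num 0 · (ƛ num 1)

-- invᵣ · k represents 1 / (k + 1).
invᵣ : Tm Γ (O ⟶ 𝟏)
invᵣ = ƛ norm · (ƛ quot · (pow2 · v₀) · v₁) · (ƛ num 0)

-- γ ↦ γ_[0,1]
clip : Tm Γ (𝟏 ⟶ 𝟏)
clip = ƛ maxᵣ · (natᵣ · num 0) · (minᵣ · (natᵣ · num 1) · (nrm · v₀))

------------------------------------------------------------------------
-- Formulas

infix  4 _≐_ _≤₀_ _≤ᵣ_ _<ᵣ_ _=ᵣ_ _=ₓ_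
infixr 3 _∧̇_
infixr 2 _∨̇_
infixr 1 _⊃_
infixr 0 ∀̇[_]_ ∃̇[_]_

data Fm (Γ : Cx) : Set where
  _≐_         : Tm Γ O → Tm Γ O → Fm Γ
  ⊥̇           : Fm Γ
  _∧̇_ _∨̇_ _⊃_ : Fm Γ → Fm Γ → Fm Γ
  ∀̇[_]_ ∃̇[_]_ : ∀ σ → Fm (σ ∷ Γ) → Fm Γ

¬̇_ : Fm Γ → Fm Γ
¬̇ A = A ⊃ ⊥̇

⊤̇ : Fm Γ
⊤̇ = ¬̇ ⊥̇

⋀ : (n : ℕ) → (Fin n → Fm Γ) → Fm Γ
⋀ zero    A = ⊤̇
⋀ (suc n) A = A zero ∧̇ ⋀ n (λ i → A (suc i))

renF : Γ ⊆ Θ → Fm Γ → Fm Θ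
renF r (s ≐ t)    = ren r s ≐ ren r t
renF r ⊥̇          = ⊥̇
renF r (A ∧̇ B)    = renF r A ∧̇ renF r B
renF r (A ∨̇ B)    = renF r A ∨̇ renF r B
renF r (A ⊃ B)    = renF r A ⊃ renF r B
renF r (∀̇[ σ ] A) = ∀̇[ σ ] renF (∷⁺ʳ σ r) A
renF r (∃̇[ σ ] A) = ∃̇[ σ ] renF (∷⁺ʳ σ r) A

subF : Sub Γ Θ → Fm Γ → Fm Θ
subF f (s ≐ t)    = sub f s ≐ sub f t
subF f ⊥̇          = ⊥̇
subF f (A ∧̇ B)    = subF f A ∧̇ subF f B
subF f (A ∨̇ B)    = subF f A ∨̇ subF f B
subF f (A ⊃ B)    = subF f A ⊃ subF f B
subF f (∀̇[ σ ] A) = ∀̇[ σ ] subF (lift f) A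
subF f (∃̇[ σ ] A) = ∃̇[ σ ] subF (lift f) A

weaken : Fm Γ → Fm (σ ∷ Γ)
weaken = renF there

-- Insert a fresh variable below the two most recent ones.
weaken₂ : Fm (σ ∷ τ ∷ Γ) → Fm (σ ∷ τ ∷ ρ ∷ Γ)
weaken₂ = renF (∷⁺ʳ _ (∷⁺ʳ _ there))

infix 10 _[_] _[_]⁺

_[_] : Fm (σ ∷ Γ) → Tm Γ σ → Fm Γ
A [ t ] = subF (inst t) A

_[_]⁺ : Fm (σ ∷ Γ) → Tm (τ ∷ Γ) σ → Fm (τ ∷ Γ)
A [ t ]⁺ = subF (inst⁺ t) A

closure : Fm Γ → Fm []
closure {Γ = []}    A = A
closure {Γ = σ ∷ Γ} A = closure (∀̇[ σ ] A)

_≤₀_ : Tm Γ O → Tm Γ O → Fm Γ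
s ≤₀ t = s ∸̇ t ≐ num 0

∀̇≤ ∃̇≤ : Tm Γ O → Fm (O ∷ Γ) → Fm Γ
∀̇≤ t A = ∀̇[ O ] (v₀ ≤₀ t ↑ ⊃ A)
∃̇≤ t A = ∃̇[ O ] (v₀ ≤₀ t ↑ ∧̇ A)

∀̇∈[0,1] ∃̇∈[0,1] : Fm (𝟏 ∷ Γ) → Fm Γ
∀̇∈[0,1] A = ∀̇[ 𝟏 ] A [ clip · v₀ ]⁺
∃̇∈[0,1] A = ∃̇[ 𝟏 ] A [ clip · v₀ ]⁺

-- With x̂ₙ = pos x n − neg x n (so |2ⁿ x − x̂ₙ| ≤ 1):
-- x ≤ y  iff  x̂ₙ ≤ ŷₙ + 2 for all n,  and  x < y  iff  x̂ₙ + 2 < ŷₙ for some n.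
_≤ᵣ_ _<ᵣ_ _=ᵣ_ : Tm Γ 𝟏 → Tm Γ 𝟏 → Fm Γ
x ≤ᵣ y = ∀̇[ O ] (pos · x ↑ · v₀ ∔ neg · y ↑ · v₀
                   ≤₀ pos · y ↑ · v₀ ∔ neg · x ↑ · v₀ ∔ num 2)
x <ᵣ y = ∃̇[ O ] (𝐬· (pos · x ↑ · v₀ ∔ neg · y ↑ · v₀ ∔ num 2)
                   ≤₀ pos · y ↑ · v₀ ∔ neg · x ↑ · v₀)
x =ᵣ y = (x ≤ᵣ y) ∧̇ (y ≤ᵣ x)

dist : Tm Γ X → Tm Γ X → Tm Γ 𝟏
dist x y = con 𝐝 · x · y

infixl 6 _+ᵣ_

_+ᵣ_ : Tm Γ 𝟏 → Tm Γ 𝟏 → Tm Γ 𝟏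
x +ᵣ y = addᵣ · x · y

_=ₓ_ : Tm Γ X → Tm Γ X → Fm Γ
x =ₓ y = dist x y =ᵣ natᵣ · num 0

Eq : ∀ σ → Tm Γ σ → Tm Γ σ → Fm Γ
Eq O       s t = s ≐ t
Eq X       s t = s =ₓ t
Eq (σ ⟶ τ) s t = ∀̇[ σ ] Eq τ (s ↑ · v₀) (t ↑ · v₀)

data QuantFree : Fm Γ → Set where
  atom : (s t : Tm Γ O) → QuantFree (s ≐ t)
  bot  : QuantFree {Γ} ⊥̇
  and  : {A B : Fm Γ} → QuantFree A → QuantFree B → QuantFree (A ∧̇ B)
  or   : {A B : Fm Γ} → QuantFree A → QuantFree B → QuantFree (A ∨̇ B)
  imp  : {A B : Fm Γ} → QuantFree A → QuantFree B → QuantFree (A ⊃ B)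

data Bounded {Γ : Cx} : Fm Γ → Set where
  atom : (s t : Tm Γ O) → Bounded (s ≐ t)
  bot  : Bounded ⊥̇
  and  : {A B : Fm Γ} → Bounded A → Bounded B → Bounded (A ∧̇ B)
  or   : {A B : Fm Γ} → Bounded A → Bounded B → Bounded (A ∨̇ B)
  imp  : {A B : Fm Γ} → Bounded A → Bounded B → Bounded (A ⊃ B)
  all≤ : (t : Tm Γ O) {A : Fm (O ∷ Γ)} → Bounded A → Bounded (∀̇≤ t A)
  ex≤  : (t : Tm Γ O) {A : Fm (O ∷ Γ)} → Bounded A → Bounded (∃̇≤ t A)
  allX : {A : Fm (X ∷ Γ)} → Bounded A → Bounded (∀̇[ X ] A)
  exX  : {A : Fm (X ∷ Γ)} → Bounded A → Bounded (∃̇[ X ] A)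
  allI : {A : Fm (𝟏 ∷ Γ)} → Bounded A → Bounded (∀̇∈[0,1] A)
  exI  : {A : Fm (𝟏 ∷ Γ)} → Bounded A → Bounded (∃̇∈[0,1] A)

data Σ-Formula {Γ : Cx} : Fm Γ → Set where
  ex : {B : Fm (O ∷ Γ)} → Bounded B → Σ-Formula (∃̇[ O ] B)

------------------------------------------------------------------------
-- Derivations

Theory : Set₁
Theory = ∀ {Γ} → Fm Γ → Set

infix -1 _∣_⊢_ _⊢_

-- Natural deduction for classical many-sorted logic, together with the
-- quantifier-free extensionality rule, whose premise must be derived
-- without open hypotheses.  As free variables are tracked by the context,
-- `inhabited` expresses the usual convention that all sorts are nonempty.
data _∣_⊢_ (𝒯 : Theory) {Γ : Cx} (Δ : List (Fm Γ)) : Fm Γ → Set where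
  axiom : {A : Fm Γ} → 𝒯 A → 𝒯 ∣ Δ ⊢ A
  hyp   : {A : Fm Γ} → A ∈ Δ → 𝒯 ∣ Δ ⊢ A
  raa   : {A : Fm Γ} → 𝒯 ∣ ¬̇ A ∷ Δ ⊢ ⊥̇ → 𝒯 ∣ Δ ⊢ A
  ∧I    : {A B : Fm Γ} → 𝒯 ∣ Δ ⊢ A → 𝒯 ∣ Δ ⊢ B → 𝒯 ∣ Δ ⊢ A ∧̇ B
  ∧E₁   : {A B : Fm Γ} → 𝒯 ∣ Δ ⊢ A ∧̇ B → 𝒯 ∣ Δ ⊢ A
  ∧E₂   : {A B : Fm Γ} → 𝒯 ∣ Δ ⊢ A ∧̇ B → 𝒯 ∣ Δ ⊢ B
  ∨I₁   : {A B : Fm Γ} → 𝒯 ∣ Δ ⊢ A → 𝒯 ∣ Δ ⊢ A ∨̇ B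
  ∨I₂   : {A B : Fm Γ} → 𝒯 ∣ Δ ⊢ B → 𝒯 ∣ Δ ⊢ A ∨̇ B
  ∨E    : {A B C : Fm Γ} → 𝒯 ∣ Δ ⊢ A ∨̇ B →
          𝒯 ∣ A ∷ Δ ⊢ C → 𝒯 ∣ B ∷ Δ ⊢ C → 𝒯 ∣ Δ ⊢ C
  ⊃I    : {A B : Fm Γ} → 𝒯 ∣ A ∷ Δ ⊢ B → 𝒯 ∣ Δ ⊢ A ⊃ B
  ⊃E    : {A B : Fm Γ} → 𝒯 ∣ Δ ⊢ A ⊃ B → 𝒯 ∣ Δ ⊢ A → 𝒯 ∣ Δ ⊢ B
  ∀I    : {A : Fm (σ ∷ Γ)} → 𝒯 ∣ map weaken Δ ⊢ A → 𝒯 ∣ Δ ⊢ ∀̇[ σ ] A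
  ∀E    : {A : Fm (σ ∷ Γ)} → 𝒯 ∣ Δ ⊢ ∀̇[ σ ] A → (t : Tm Γ σ) → 𝒯 ∣ Δ ⊢ A [ t ]
  ∃I    : {A : Fm (σ ∷ Γ)} (t : Tm Γ σ) → 𝒯 ∣ Δ ⊢ A [ t ] → 𝒯 ∣ Δ ⊢ ∃̇[ σ ] A
  ∃E    : {A : Fm (σ ∷ Γ)} {C : Fm Γ} → 𝒯 ∣ Δ ⊢ ∃̇[ σ ] A →
          𝒯 ∣ A ∷ map weaken Δ ⊢ weaken C → 𝒯 ∣ Δ ⊢ C
  inhabited : ∀ σ → 𝒯 ∣ Δ ⊢ ∃̇[ σ ] ⊤̇
  qf-er : {A : Fm Γ} → QuantFree A → (s t : Tm Γ ρ) (r : Tm (ρ ∷ Γ) τ) →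
          𝒯 ∣ [] ⊢ A ⊃ Eq ρ s t → 𝒯 ∣ Δ ⊢ A ⊃ Eq τ (r [ s ]ᵗ) (r [ t ]ᵗ)

_⊢_ : Theory → Fm [] → Set
𝒯 ⊢ A = 𝒯 ∣ [] ⊢ A

data 𝒯ₘ {Γ : Cx} : Fm Γ → Set where
  ≐-refl  : (t : Tm Γ O) → 𝒯ₘ (t ≐ t)
  ≐-subst : (A : Fm (O ∷ Γ)) (s t : Tm Γ O) → 𝒯ₘ (s ≐ t ⊃ A [ s ] ⊃ A [ t ])

  -- Only =₀ is primitive, so the defining equations of the combinators and
  -- recursors are stated inside an arbitrary type-0 context r.
  𝐊-eq  : (r : Tm (σ ∷ Γ) O) (x : Tm Γ σ) (y : Tm Γ τ) →
          𝒯ₘ (r [ con 𝐊 · x · y ]ᵗ ≐ r [ x ]ᵗ)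
  𝐒-eq  : (r : Tm (τ ∷ Γ) O)
          (x : Tm Γ (ρ ⟶ σ ⟶ τ)) (y : Tm Γ (ρ ⟶ σ)) (z : Tm Γ ρ) →
          𝒯ₘ (r [ con 𝐒 · x · y · z ]ᵗ ≐ r [ x · z · (y · z) ]ᵗ)
  𝐑-zero : (r : Tm (ρ ∷ Γ) O) (y : Tm Γ ρ) (z : Tm Γ (ρ ⟶ O ⟶ ρ)) →
           𝒯ₘ (r [ rec (num 0) y z ]ᵗ ≐ r [ y ]ᵗ)
  𝐑-suc  : (r : Tm (ρ ∷ Γ) O) (n : Tm Γ O) (y : Tm Γ ρ) (z : Tm Γ (ρ ⟶ O ⟶ ρ)) →
           𝒯ₘ (r [ rec (𝐬· n) y z ]ᵗ ≐ r [ z · rec n y z · n ]ᵗ)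

  suc-inj   : (s t : Tm Γ O) → 𝒯ₘ (𝐬· s ≐ 𝐬· t ⊃ s ≐ t)
  suc≢zero  : (t : Tm Γ O) → 𝒯ₘ (¬̇ (𝐬· t ≐ num 0))
  induction : (A : Fm (O ∷ Γ)) →
              𝒯ₘ (A [ num 0 ] ⊃ (∀̇[ O ] (A ⊃ A [ 𝐬· v₀ ]⁺)) ⊃ (∀̇[ O ] A))

  d-rep   : 𝒯ₘ (∀̇[ X ] ∀̇[ X ] ∀̇[ O ] dist v₂ v₁ · v₀ ≐ nrm · dist v₂ v₁ · v₀)
  d-refl  : 𝒯ₘ (∀̇[ X ] dist v₀ v₀ =ᵣ natᵣ · num 0)
  d-sym   : 𝒯ₘ (∀̇[ X ] ∀̇[ X ] dist v₁ v₀ =ᵣ dist v₀ v₁)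
  d-tri   : 𝒯ₘ (∀̇[ X ] ∀̇[ X ] ∀̇[ X ] dist v₂ v₀ ≤ᵣ dist v₂ v₁ +ᵣ dist v₁ v₀)
  d-bound : 𝒯ₘ (∀̇[ X ] ∀̇[ X ] dist v₁ v₀ ≤ᵣ natᵣ · con 𝐛)

data 𝒯ₘ⁺ {Γ : Cx} : Fm Γ → Set where
  base   : {A : Fm Γ} → 𝒯ₘ A → 𝒯ₘ⁺ A
  choice : {A : Fm (O ∷ O ∷ Γ)} → Σ-Formula A →
           𝒯ₘ⁺ ((∀̇[ O ] ∃̇[ O ] A) ⊃
                (∃̇[ 𝟏 ] ∀̇[ O ] ∃̇≤ (tilde · v₁ · v₀) (weaken₂ A)))
  collection≤ : {A : Fm (O ∷ O ∷ Γ)} → Σ-Formula A → (m : Tm Γ O) →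
           𝒯ₘ⁺ (∀̇≤ m (∃̇[ O ] A) ⊃ (∃̇[ O ] ∀̇≤ (m ↑) (∃̇≤ v₁ (weaken₂ A))))
  collectionI : {A : Fm (O ∷ 𝟏 ∷ Γ)} → Σ-Formula A →
           𝒯ₘ⁺ (∀̇∈[0,1] (∃̇[ O ] A) ⊃ (∃̇[ O ] ∀̇∈[0,1] (∃̇≤ v₁ (weaken₂ A))))
  collectionX : {A : Fm (O ∷ X ∷ Γ)} → Σ-Formula A →
           𝒯ₘ⁺ ((∀̇[ X ] ∃̇[ O ] A) ⊃ (∃̇[ O ] ∀̇[ X ] ∃̇≤ v₁ (weaken₂ A)))

------------------------------------------------------------------------
-- The mathematical statement

-- U₀, …, φ₀, …, and the sequence u
Data : ℕ → Cx
Data ℓ = (O ⟶ X) ∷ replicate ℓ (X ⟶ X ⟶ 𝟏) ++ replicate ℓ (X ⟶ X)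

position : ∀ {n} → Fin n → σ ∈ replicate n σ
position zero    = here refl
position (suc i) = there (position i)

module Maps (ℓ : ℕ) where

  U : Fin ℓ → Tm (Data ℓ) (X ⟶ X)
  U i = var (there (∈-++⁺ʳ (replicate ℓ (X ⟶ X ⟶ 𝟏)) (position i)))

  φ : Fin ℓ → Tm (Data ℓ) (X ⟶ X ⟶ 𝟏)
  φ i = var (there (∈-++⁺ˡ (position i)))

  u : Tm (Data ℓ) (O ⟶ X)
  u = var (here refl)

-- lim d(V(wₙ), wₙ) = 0
AsymptoticallyFixed : Tm Γ (X ⟶ X) → Tm Γ (O ⟶ X) → Fm Γ
AsymptoticallyFixed V w =
  ∀̇[ O ] ∃̇[ O ] ∀̇[ O ]
    (v₁ ≤₀ v₀ ⊃ dist (V ↑ ↑ ↑ · (w ↑ ↑ ↑ · v₀)) (w ↑ ↑ ↑ · v₀) ≤ᵣ invᵣ · v₂)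

-- x ∈ Fix(V₀) ∩ … ∩ Fix(Vₙ₋₁)
_∈Fix_ : ∀ {n} → Tm Γ X → (Fin n → Tm Γ (X ⟶ X)) → Fm Γ
x ∈Fix V = ⋀ _ (λ i → V i · x =ₓ x)

-- ψᵢ(x,x) < ψᵢ(x,y) + 1/(k+1) for all i < n
AlmostMinimal : ∀ {n} → (Fin n → Tm Γ (X ⟶ X ⟶ 𝟏)) →
                Tm Γ X → Tm Γ X → Tm Γ O → Fm Γ
AlmostMinimal ψ x y k =
  ⋀ _ (λ i → ψ i · x · x <ᵣ ψ i · x · y +ᵣ invᵣ · k)

module Submission where

open import Data.Fin using (Fin; zero; suc)
open import Data.List using (List; []; _∷_; map)
open import Data.List.Membership.Propositional using (_∈_)
open import Data.List.Relation.Binary.Subset.Propositional using (_⊆_)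
open import Data.List.Relation.Binary.Subset.Propositional.Properties using (∷⁺ʳ; map⁺)
open import Data.List.Relation.Unary.Any using (here; there)
open import Data.Nat using (ℕ; zero; suc; NonZero)
import Data.Nat as ℕ
open import Data.Product using (Σ; _×_; _,_; proj₁; proj₂)
open import Data.Vec using (Vec; []; _∷_; lookup; zipWith; replicate)
open import Relation.Binary.PropositionalEquality using (_≡_; refl; sym; trans; cong; cong₂)
open import Defs

-- Membership in F is universal in the precision and a strict inequality is existential in it.
-- Merging the two precisions into one n leaves a matrix without unbounded quantifiers, and this is
-- what makes collection over X applicable; collection takes the place of compactness and continuity
-- arguments. Once a precision is fixed, every comparison of reals is an inequality between integer
-- partial sums. The numerical constants have two sources: the slack of 2 in each comparison, and
-- the look-ahead of three places by which `norm` chooses its digits. The theory offers only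
-- recursor equations and induction for such inequalities. They are therefore derived from
-- certificates: nonnegative multipliers for the known facts are given explicitly, and `refl` checks
-- the resulting coefficient vectors.

-- "y ∈ F implies φᵢ(x,x) < φᵢ(x,y) + 1/(k+1) for all i" unfolds classically
-- to ∀y ∃n A(y,n), where A says: if all d(Uᵢ(y),y) ≤ 0 hold at precision n,
-- then all the strict inequalities hold at precisions below n.  Bounded
-- collection over X bounds n by some N uniformly in y.  Since the u_m are
-- asymptotically fixed, d(Uᵢ(u_m),u_m) ≤ 0 holds at all precisions up to N
-- for large m, which gives the conclusion for y = u_m.
--
-- Apart from logic this uses two facts on signed digit representations, that
-- 1/(k+1) is 0 at precision n once k ≥ 2ⁿ⁺³, and that d(x,y) ≥ 0.  The latter
-- is not an axiom: it follows from the triangle inequality, and so needs an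
-- upper bound for the sum of two reals in terms of its partial sums.

-- Substitution

variable
  Ξ : Cx
  A B C : Fm Γ
  Δ : List (Fm Γ)

infixl 5 _▹_

_▹_ : Sub Γ Θ → Tm Θ σ → Sub (σ ∷ Γ) Θ
(f ▹ t) (here refl) = t
(f ▹ t) (there x)   = f x

infix 4 _≗ˢ_
_≗ˢ_ : Sub Γ Θ → Sub Γ Θ → Set
f ≗ˢ g = ∀ {σ} (x : σ ∈ _) → f x ≡ g x

sub-cong : {f g : Sub Γ Θ} → f ≗ˢ g → (t : Tm Γ σ) → sub f t ≡ sub g t
sub-cong e (var x) = e x
sub-cong e (con c) = refl
sub-cong e (s · t) = cong₂ _·_ (sub-cong e s) (sub-cong e t)

sub-var : (t : Tm Γ σ) → sub var t ≡ t
sub-var (var x) = refl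
sub-var (con c) = refl
sub-var (s · t) = cong₂ _·_ (sub-var s) (sub-var t)

sub-ren : (f : Sub Θ Ξ) (r : Γ ⊆ Θ) (t : Tm Γ σ) → sub f (ren r t) ≡ sub (λ x → f (r x)) t
sub-ren f r (var x) = refl
sub-ren f r (con c) = refl
sub-ren f r (s · t) = cong₂ _·_ (sub-ren f r s) (sub-ren f r t)

ren-sub : (r : Θ ⊆ Ξ) (f : Sub Γ Θ) (t : Tm Γ σ) → ren r (sub f t) ≡ sub (λ x → ren r (f x)) t
ren-sub r f (var x) = refl
ren-sub r f (con c) = refl
ren-sub r f (s · t) = cong₂ _·_ (ren-sub r f s) (ren-sub r f t)

sub-sub : (g : Sub Θ Ξ) (f : Sub Γ Θ) (t : Tm Γ σ) → sub g (sub f t) ≡ sub (λ x → sub g (f x)) t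
sub-sub g f (var x) = refl
sub-sub g f (con c) = refl
sub-sub g f (s · t) = cong₂ _·_ (sub-sub g f s) (sub-sub g f t)

lift-cong : {f g : Sub Γ Θ} → f ≗ˢ g → lift {ρ = ρ} f ≗ˢ lift g
lift-cong e (here refl) = refl
lift-cong e (there x)   = cong _↑ (e x)

subF-cong : {f g : Sub Γ Θ} → f ≗ˢ g → (A : Fm Γ) → subF f A ≡ subF g A
subF-cong e (s ≐ t)    = cong₂ _≐_ (sub-cong e s) (sub-cong e t)
subF-cong e ⊥̇          = refl
subF-cong e (A ∧̇ B)    = cong₂ _∧̇_ (subF-cong e A) (subF-cong e B)
subF-cong e (A ∨̇ B)    = cong₂ _∨̇_ (subF-cong e A) (subF-cong e B)
subF-cong e (A ⊃ B)    = cong₂ _⊃_ (subF-cong e A) (subF-cong e B)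
subF-cong e (∀̇[ σ ] A) = cong (∀̇[ σ ]_) (subF-cong (lift-cong e) A)
subF-cong e (∃̇[ σ ] A) = cong (∃̇[ σ ]_) (subF-cong (lift-cong e) A)

lift-var : lift {ρ = ρ} (var {Γ = Γ}) ≗ˢ var
lift-var (here refl) = refl
lift-var (there x)   = refl

subF-var : (A : Fm Γ) → subF var A ≡ A
subF-var (s ≐ t)    = cong₂ _≐_ (sub-var s) (sub-var t)
subF-var ⊥̇          = refl
subF-var (A ∧̇ B)    = cong₂ _∧̇_ (subF-var A) (subF-var B)
subF-var (A ∨̇ B)    = cong₂ _∨̇_ (subF-var A) (subF-var B)
subF-var (A ⊃ B)    = cong₂ _⊃_ (subF-var A) (subF-var B)
subF-var (∀̇[ σ ] A) = cong (∀̇[ σ ]_) (trans (subF-cong lift-var A) (subF-var A))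
subF-var (∃̇[ σ ] A) = cong (∃̇[ σ ]_) (trans (subF-cong lift-var A) (subF-var A))

lift-ren : (f : Sub Θ Ξ) (r : Γ ⊆ Θ) →
           (λ {σ} (x : σ ∈ ρ ∷ Γ) → lift f (∷⁺ʳ ρ r x)) ≗ˢ lift (λ x → f (r x))
lift-ren f r (here refl) = refl
lift-ren f r (there x)   = refl

subF-renF : (f : Sub Θ Ξ) (r : Γ ⊆ Θ) (A : Fm Γ) → subF f (renF r A) ≡ subF (λ x → f (r x)) A
subF-renF f r (s ≐ t)    = cong₂ _≐_ (sub-ren f r s) (sub-ren f r t)
subF-renF f r ⊥̇          = refl
subF-renF f r (A ∧̇ B)    = cong₂ _∧̇_ (subF-renF f r A) (subF-renF f r B)
subF-renF f r (A ∨̇ B)    = cong₂ _∨̇_ (subF-renF f r A) (subF-renF f r B)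
subF-renF f r (A ⊃ B)    = cong₂ _⊃_ (subF-renF f r A) (subF-renF f r B)
subF-renF f r (∀̇[ σ ] A) =
  cong (∀̇[ σ ]_) (trans (subF-renF (lift f) (∷⁺ʳ σ r) A) (subF-cong (lift-ren f r) A))
subF-renF f r (∃̇[ σ ] A) =
  cong (∃̇[ σ ]_) (trans (subF-renF (lift f) (∷⁺ʳ σ r) A) (subF-cong (lift-ren f r) A))

renF-as-subF : (r : Γ ⊆ Θ) (A : Fm Γ) → renF r A ≡ subF (λ x → var (r x)) A
renF-as-subF r A = trans (sym (subF-var (renF r A))) (subF-renF var r A)

sub-lift-↑ : (f : Sub Γ Θ) (t : Tm Γ σ) → sub (lift {ρ = ρ} f) (t ↑) ≡ sub f t ↑
sub-lift-↑ f t = trans (sub-ren (lift f) there t) (sym (ren-sub there f t))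

lift-lift : (g : Sub Θ Ξ) (f : Sub Γ Θ) →
            (λ {σ} (x : σ ∈ ρ ∷ Γ) → sub (lift g) (lift f x)) ≗ˢ lift (λ x → sub g (f x))
lift-lift g f (here refl) = refl
lift-lift g f (there x)   = sub-lift-↑ g (f x)

subF-subF : (g : Sub Θ Ξ) (f : Sub Γ Θ) (A : Fm Γ) → subF g (subF f A) ≡ subF (λ x → sub g (f x)) A
subF-subF g f (s ≐ t)    = cong₂ _≐_ (sub-sub g f s) (sub-sub g f t)
subF-subF g f ⊥̇          = refl
subF-subF g f (A ∧̇ B)    = cong₂ _∧̇_ (subF-subF g f A) (subF-subF g f B)
subF-subF g f (A ∨̇ B)    = cong₂ _∨̇_ (subF-subF g f A) (subF-subF g f B)
subF-subF g f (A ⊃ B)    = cong₂ _⊃_ (subF-subF g f A) (subF-subF g f B)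
subF-subF g f (∀̇[ σ ] A) =
  cong (∀̇[ σ ]_) (trans (subF-subF (lift g) (lift f) A) (subF-cong (lift-lift g f) A))
subF-subF g f (∃̇[ σ ] A) =
  cong (∃̇[ σ ]_) (trans (subF-subF (lift g) (lift f) A) (subF-cong (lift-lift g f) A))

↑-inst : (s : Tm Γ σ) (t : Tm Γ ρ) → s ↑ [ t ]ᵗ ≡ s
↑-inst s t = trans (sub-ren (inst t) there s) (sub-var s)

subF-▹ : (f : Sub Γ Θ) (t : Tm Θ σ) (A : Fm (σ ∷ Γ)) → subF (lift f) A [ t ] ≡ subF (f ▹ t) A
subF-▹ f t A = trans (subF-subF (inst t) (lift f) A) (subF-cong eq A)
  where
  eq : (λ {τ} (x : τ ∈ _) → sub (inst t) (lift f x)) ≗ˢ (f ▹ t)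
  eq (here refl) = refl
  eq (there x)   = ↑-inst (f x) t

renF-∷-inst : (A : Fm (σ ∷ Γ)) → renF (∷⁺ʳ σ there) A [ v₀ ] ≡ A
renF-∷-inst A = trans (subF-renF (inst v₀) (∷⁺ʳ _ there) A) (trans (subF-cong eq A) (subF-var A))
  where
  eq : (λ {τ} (x : τ ∈ _) → inst v₀ (∷⁺ʳ _ there x)) ≗ˢ var
  eq (here refl) = refl
  eq (there x)   = refl

-- Derived rules

infix -1 _⊩_

_⊩_ : List (Fm Γ) → Fm Γ → Set
Δ ⊩ A = 𝒯ₘ⁺ ∣ Δ ⊢ A

cast : A ≡ B → Δ ⊩ A → Δ ⊩ B
cast refl p = p

ax : 𝒯ₘ A → Δ ⊩ A
ax a = axiom (base a)

h₀ : A ∷ Δ ⊩ A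
h₀ = hyp (here refl)

h₁ : B ∷ A ∷ Δ ⊩ A
h₁ = hyp (there (here refl))

h₂ : C ∷ B ∷ A ∷ Δ ⊩ A
h₂ = hyp (there (there (here refl)))

h₃ : {D : Fm Γ} → D ∷ C ∷ B ∷ A ∷ Δ ⊩ A
h₃ = hyp (there (there (there (here refl))))

cut : Δ ⊩ A → A ∷ Δ ⊩ B → Δ ⊩ B
cut p q = ⊃E (⊃I q) p

⊃E₂ : Δ ⊩ A ⊃ B ⊃ C → Δ ⊩ A → Δ ⊩ B → Δ ⊩ C
⊃E₂ p q r = ⊃E (⊃E p q) r

⊥E : Δ ⊩ ⊥̇ → Δ ⊩ A
⊥E p = ⊃E (⊃I (raa h₁)) p

excluded-middle : Δ ⊩ A ∨̇ ¬̇ A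
excluded-middle = raa (⊃E h₀ (∨I₂ (⊃I (⊃E h₁ (∨I₁ h₀)))))

⊩-mono : {Δ Δ′ : List (Fm Γ)} → Δ ⊆ Δ′ → Δ ⊩ A → Δ′ ⊩ A
⊩-mono i (axiom a)       = axiom a
⊩-mono i (hyp x)         = hyp (i x)
⊩-mono i (raa p)         = raa (⊩-mono (∷⁺ʳ _ i) p)
⊩-mono i (∧I p q)        = ∧I (⊩-mono i p) (⊩-mono i q)
⊩-mono i (∧E₁ p)         = ∧E₁ (⊩-mono i p)
⊩-mono i (∧E₂ p)         = ∧E₂ (⊩-mono i p)
⊩-mono i (∨I₁ p)         = ∨I₁ (⊩-mono i p)
⊩-mono i (∨I₂ p)         = ∨I₂ (⊩-mono i p)
⊩-mono i (∨E p q r)      = ∨E (⊩-mono i p) (⊩-mono (∷⁺ʳ _ i) q) (⊩-mono (∷⁺ʳ _ i) r)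
⊩-mono i (⊃I p)          = ⊃I (⊩-mono (∷⁺ʳ _ i) p)
⊩-mono i (⊃E p q)        = ⊃E (⊩-mono i p) (⊩-mono i q)
⊩-mono i (∀I p)          = ∀I (⊩-mono (map⁺ weaken i) p)
⊩-mono i (∀E p t)        = ∀E (⊩-mono i p) t
⊩-mono i (∃I t p)        = ∃I t (⊩-mono i p)
⊩-mono i (∃E p q)        = ∃E (⊩-mono i p) (⊩-mono (∷⁺ʳ _ (map⁺ weaken i)) q)
⊩-mono i (inhabited σ)   = inhabited σ
⊩-mono i (qf-er a s t r p) = qf-er a s t r p

wk : Δ ⊩ A → B ∷ Δ ⊩ A
wk = ⊩-mono there

-- Iterating `∀E` would leave terms such as `t ↑ [ s ]ᵗ`, equal to `t` only propositionally.
-- Accumulating one simultaneous substitution makes the final instance compute.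
∀E▹ : (f : Sub Γ Θ) (A : Fm (σ ∷ Γ)) {Δ : List (Fm Θ)} →
      Δ ⊩ subF f (∀̇[ σ ] A) → (t : Tm Θ σ) → Δ ⊩ subF (f ▹ t) A
∀E▹ f A p t = cast (subF-▹ f t A) (∀E p t)

spec₁ : {A : Fm (σ ∷ Γ)} → Δ ⊩ ∀̇[ σ ] A → (t : Tm Γ σ) → Δ ⊩ subF (var ▹ t) A
spec₁ p t = ∀E▹ var _ (cast (sym (subF-var _)) p) t

spec₂ : {A : Fm (σ ∷ τ ∷ Γ)} → Δ ⊩ ∀̇[ τ ] ∀̇[ σ ] A →
        (t : Tm Γ τ) (s : Tm Γ σ) → Δ ⊩ subF (var ▹ t ▹ s) A
spec₂ p t s = ∀E▹ _ _ (spec₁ p t) s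

spec₃ : {A : Fm (ρ ∷ σ ∷ τ ∷ Γ)} → Δ ⊩ ∀̇[ τ ] ∀̇[ σ ] ∀̇[ ρ ] A →
        (t : Tm Γ τ) (s : Tm Γ σ) (r : Tm Γ ρ) → Δ ⊩ subF (var ▹ t ▹ s ▹ r) A
spec₃ p t s r = ∀E▹ _ _ (spec₂ p t s) r

-- Below `∀I` or `∃E` a quantified hypothesis appears weakened; instantiating it at the fresh
-- variable gives back its body. `rebind` is the dual for a goal.
unbind : (A : Fm (σ ∷ Γ)) {Δ : List (Fm (σ ∷ Γ))} → Δ ⊩ weaken (∀̇[ σ ] A) → Δ ⊩ A
unbind A p = cast (renF-∷-inst A) (∀E p v₀)

rebind : (A : Fm (σ ∷ Γ)) {Δ : List (Fm (σ ∷ Γ))} → Δ ⊩ A → Δ ⊩ weaken (∃̇[ σ ] A)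
rebind A p = ∃I v₀ (cast (sym (renF-∷-inst A)) p)

¬∀⇒∃¬ : (A : Fm (σ ∷ Γ)) → Δ ⊩ ¬̇ (∀̇[ σ ] A) → Δ ⊩ ∃̇[ σ ] ¬̇ A
¬∀⇒∃¬ A p = raa (⊃E (wk p) (∀I (raa (⊃E h₁ (rebind (¬̇ A) h₀)))))

ind : (A : Fm (O ∷ Γ)) → Δ ⊩ A [ num 0 ] → A ∷ map weaken Δ ⊩ A [ 𝐬· v₀ ]⁺ → Δ ⊩ ∀̇[ O ] A
ind A p q = ⊃E₂ (ax (induction A)) p (∀I (⊃I q))

closureI : (Γ : Cx) {A : Fm Γ} → [] ⊩ A → [] ⊩ closure A
closureI []      p = p
closureI (σ ∷ Γ) p = closureI Γ (∀I p)

-- Equality and conversion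

≐-rfl : {t : Tm Γ O} → Δ ⊩ t ≐ t
≐-rfl = ax (≐-refl _)

≐-sym : {s t : Tm Γ O} → Δ ⊩ s ≐ t → Δ ⊩ t ≐ s
≐-sym {s = s} {t} p =
  cast (cong (t ≐_) (↑-inst s t))
    (⊃E₂ (ax (≐-subst (v₀ ≐ s ↑) s t)) p (cast (cong (s ≐_) (sym (↑-inst s s))) ≐-rfl))

≐-trans : {r s t : Tm Γ O} → Δ ⊩ r ≐ s → Δ ⊩ s ≐ t → Δ ⊩ r ≐ t
≐-trans {r = r} {s} {t} p q =
  cast (cong (_≐ t) (↑-inst r t))
    (⊃E₂ (ax (≐-subst (r ↑ ≐ v₀) s t)) q (cast (cong (_≐ s) (sym (↑-inst r s))) p))

≐-cong : (r : Tm (O ∷ Γ) O) {s t : Tm Γ O} → Δ ⊩ s ≐ t → Δ ⊩ r [ s ]ᵗ ≐ r [ t ]ᵗ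
≐-cong r {s} {t} p =
  cast (cong (_≐ r [ t ]ᵗ) (↑-inst (r [ s ]ᵗ) t))
    (⊃E₂ (ax (≐-subst (r [ s ]ᵗ ↑ ≐ r) s t)) p
      (cast (cong (_≐ r [ s ]ᵗ) (sym (↑-inst (r [ s ]ᵗ) s))) ≐-rfl))

sub-inst⁺ : (r : Tm (σ ∷ Γ) ρ) (c : Tm (τ ∷ Γ) σ) (t : Tm Γ τ) →
            sub (inst⁺ c) r [ t ]ᵗ ≡ r [ c [ t ]ᵗ ]ᵗ
sub-inst⁺ r c t = trans (sub-sub (inst t) (inst⁺ c) r) (sub-cong eq r)
  where
  eq : (λ {υ} (x : υ ∈ _) → sub (inst t) (inst⁺ c x)) ≗ˢ inst (c [ t ]ᵗ)
  eq (here refl) = refl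
  eq (there x)   = refl

infix 4 _≈_
-- Equality is primitive at type 0 only, so conversion at higher types lives outside the theory, and
-- `≈-sound` reads it as interchangeability in type-0 contexts. Terms have no binders, so congruence
-- for application suffices.
data _≈_ {Γ : Cx} : Tm Γ σ → Tm Γ σ → Set where
  ≈-refl  : {t : Tm Γ σ} → t ≈ t
  ≈-trans : {r s t : Tm Γ σ} → r ≈ s → s ≈ t → r ≈ t
  ≈-app   : {s s′ : Tm Γ (σ ⟶ τ)} {t t′ : Tm Γ σ} → s ≈ s′ → t ≈ t′ → s · t ≈ s′ · t′
  ≈-𝐊     : (x : Tm Γ σ) (y : Tm Γ τ) → con 𝐊 · x · y ≈ x
  ≈-𝐒     : (x : Tm Γ (ρ ⟶ σ ⟶ τ)) (y : Tm Γ (ρ ⟶ σ)) (z : Tm Γ ρ) →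
            con 𝐒 · x · y · z ≈ x · z · (y · z)
  ≈-𝐑0    : (y : Tm Γ ρ) (z : Tm Γ (ρ ⟶ O ⟶ ρ)) → rec (num 0) y z ≈ y
  ≈-𝐑s    : (n : Tm Γ O) (y : Tm Γ ρ) (z : Tm Γ (ρ ⟶ O ⟶ ρ)) →
            rec (𝐬· n) y z ≈ z · rec n y z · n

≈-sound : {s t : Tm Γ σ} → s ≈ t → (r : Tm (σ ∷ Γ) O) → Δ ⊩ r [ s ]ᵗ ≐ r [ t ]ᵗ
≈-sound ≈-refl r        = ≐-rfl
≈-sound (≈-trans p q) r = ≐-trans (≈-sound p r) (≈-sound q r)
-- Function and argument are exchanged one after the other, each time with the remaining one
-- absorbed into the context.
≈-sound (≈-app {s = s} {s′} {t} {t′} p q) r =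
  ≐-trans
    (cast (cong₂ _≐_ (inFun s) (inFun s′)) (≈-sound p (sub (inst⁺ (v₀ · t ↑)) r)))
    (cast (cong₂ _≐_ (inArg t) (inArg t′)) (≈-sound q (sub (inst⁺ (s′ ↑ · v₀)) r)))
  where
  inFun : ∀ s → sub (inst⁺ (v₀ · t ↑)) r [ s ]ᵗ ≡ r [ s · t ]ᵗ
  inFun s = trans (sub-inst⁺ r _ s) (cong (λ u → r [ s · u ]ᵗ) (↑-inst t s))
  inArg : ∀ t → sub (inst⁺ (s′ ↑ · v₀)) r [ t ]ᵗ ≡ r [ s′ · t ]ᵗ
  inArg t = trans (sub-inst⁺ r _ t) (cong (λ u → r [ u · t ]ᵗ) (↑-inst s′ t))
≈-sound (≈-𝐊 x y) r    = ax (𝐊-eq r x y)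
≈-sound (≈-𝐒 x y z) r  = ax (𝐒-eq r x y z)
≈-sound (≈-𝐑0 y z) r   = ax (𝐑-zero r y z)
≈-sound (≈-𝐑s n y z) r = ax (𝐑-suc r n y z)

Reduct : Tm Γ σ → Set
Reduct t = Σ _ (t ≈_)

-- The first argument bounds the number of reduction steps.
apply : ℕ → (f : Tm Γ (σ ⟶ τ)) (a : Tm Γ σ) → Reduct (f · a)
apply (suc k) (con 𝐊 · x) a = x , ≈-𝐊 x a
apply (suc k) (con 𝐒 · x · y) a =
  let f , p = apply k x a; b , q = apply k y a; c , r = apply k f b
  in c , ≈-trans (≈-𝐒 x y a) (≈-trans (≈-app p q) r)
apply (suc k) (con 𝐑 · con 𝟘 · y) a = y , ≈-𝐑0 y a
apply (suc k) (con 𝐑 · (con 𝐬 · n) · y) a =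
  let b , q = apply k (con 𝐑 · n · y) a; f , p = apply k a b; c , r = apply k f n
  in c , ≈-trans (≈-𝐑s n y a) (≈-trans (≈-app (≈-trans (≈-app ≈-refl q) p) ≈-refl) r)
apply _ f a = f · a , ≈-refl

normalise : ℕ → (t : Tm Γ σ) → Reduct t
normalise k (s · t) =
  let f , p = normalise k s; a , q = normalise k t; c , r = apply k f a
  in c , ≈-trans (≈-app p q) r
normalise k t = t , ≈-refl

-- Soundness does not depend on the number 100: when it is exhausted, the term is merely left partly
-- reduced.
nf : Tm Γ σ → Tm Γ σ
nf t = proj₁ (normalise 100 t)

conv-in : (r : Tm (σ ∷ Γ) O) (s t : Tm Γ σ) → nf s ≡ nf t → Δ ⊩ r [ s ]ᵗ ≐ r [ t ]ᵗ
conv-in r s t e =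
  ≐-trans (≈-sound (proj₂ (normalise 100 s)) r)
    (cast (cong (λ u → r [ u ]ᵗ ≐ r [ t ]ᵗ) (sym e)) (≐-sym (≈-sound (proj₂ (normalise 100 t)) r)))

conv : (s t : Tm Γ O) → nf s ≡ nf t → Δ ⊩ s ≐ t
conv = conv-in v₀

-- Arithmetic

infixr 5 _⨾_
_⨾_ : {r s t : Tm Γ O} → Δ ⊩ r ≐ s → Δ ⊩ s ≐ t → Δ ⊩ r ≐ t
_⨾_ = ≐-trans

𝐬-cong : {s t : Tm Γ O} → Δ ⊩ s ≐ t → Δ ⊩ 𝐬· s ≐ 𝐬· t
𝐬-cong = ≐-cong (𝐬· v₀)

+-cong : {s s′ t t′ : Tm Γ O} → Δ ⊩ s ≐ s′ → Δ ⊩ t ≐ t′ → Δ ⊩ s ∔ t ≐ s′ ∔ t′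
+-cong {s = s} {s′} {t} {t′} p q =
  cast (cong₂ (λ a b → s ∔ a ≐ s′ ∔ b) (↑-inst t s) (↑-inst t s′)) (≐-cong (v₀ ∔ t ↑) p)
  ⨾ cast (cong₂ (λ a b → a ∔ t ≐ b ∔ t′) (↑-inst s′ t) (↑-inst s′ t′)) (≐-cong (s′ ↑ ∔ v₀) q)

+-zero : (s : Tm Γ O) → Δ ⊩ s ∔ num 0 ≐ s
+-zero s = conv _ _ refl

-- `nf` cannot inspect an arbitrary term, so the equation is computed for object variables and then
-- specialised. The later recursion equations follow the same pattern.
+-suc : (s t : Tm Γ O) → Δ ⊩ s ∔ 𝐬· t ≐ 𝐬· (s ∔ t)
+-suc = spec₂ (∀I (∀I (conv (v₁ ∔ 𝐬· v₀) (𝐬· (v₁ ∔ v₀)) refl)))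

zero-+ : (t : Tm Γ O) → Δ ⊩ num 0 ∔ t ≐ t
zero-+ = spec₁ (ind (num 0 ∔ v₀ ≐ v₀) (+-zero _) (+-suc _ _ ⨾ 𝐬-cong h₀))

suc-+ : (s t : Tm Γ O) → Δ ⊩ 𝐬· s ∔ t ≐ 𝐬· (s ∔ t)
suc-+ = spec₂ (∀I (ind (𝐬· v₁ ∔ v₀ ≐ 𝐬· (v₁ ∔ v₀))
  (conv _ _ refl)
  (+-suc _ _ ⨾ 𝐬-cong h₀ ⨾ 𝐬-cong (≐-sym (+-suc _ _)))))

+-comm : (s t : Tm Γ O) → Δ ⊩ s ∔ t ≐ t ∔ s
+-comm = spec₂ (∀I (ind (v₁ ∔ v₀ ≐ v₀ ∔ v₁)
  (+-zero _ ⨾ ≐-sym (zero-+ _))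
  (+-suc _ _ ⨾ 𝐬-cong h₀ ⨾ ≐-sym (suc-+ _ _))))

+-assoc : (r s t : Tm Γ O) → Δ ⊩ r ∔ s ∔ t ≐ r ∔ (s ∔ t)
+-assoc = spec₃ (∀I (∀I (ind (v₂ ∔ v₁ ∔ v₀ ≐ v₂ ∔ (v₁ ∔ v₀))
  (conv _ _ refl)
  (+-suc _ _ ⨾ 𝐬-cong h₀ ⨾ conv _ _ refl))))

interchange : (a b c d : Tm Γ O) → Δ ⊩ a ∔ b ∔ (c ∔ d) ≐ a ∔ c ∔ (b ∔ d)
interchange a b c d =
  +-assoc a b (c ∔ d)
  ⨾ +-cong ≐-rfl
      (≐-sym (+-assoc b c d) ⨾ +-cong (+-comm b c) ≐-rfl ⨾ +-assoc c b d)
  ⨾ ≐-sym (+-assoc a c (b ∔ d))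


zero-* : (t : Tm Γ O) → Δ ⊩ num 0 ∗ t ≐ num 0
zero-* = spec₁ (ind (num 0 ∗ v₀ ≐ num 0) (conv _ _ refl)
  (conv _ (num 0 ∗ v₀ ∔ num 0) refl ⨾ +-zero _ ⨾ h₀))

suc-* : (s t : Tm Γ O) → Δ ⊩ 𝐬· s ∗ t ≐ t ∔ s ∗ t
suc-* = spec₂ (∀I (ind (𝐬· v₁ ∗ v₀ ≐ v₀ ∔ v₁ ∗ v₀)
  (conv _ _ refl)
  (conv _ (𝐬· v₁ ∗ v₀ ∔ 𝐬· v₁) refl
    ⨾ +-cong h₀ ≐-rfl
    ⨾ +-suc _ _
    ⨾ 𝐬-cong (+-assoc v₀ (v₁ ∗ v₀) v₁)
    ⨾ ≐-sym (suc-+ v₀ (v₁ ∗ v₀ ∔ v₁))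
    ⨾ conv _ _ refl)))

n≢n+1+m : (s t : Tm Γ O) → Δ ⊩ s ≐ s ∔ 𝐬· t → Δ ⊩ ⊥̇
n≢n+1+m s t = ⊃E (spec₂ (∀I (ind (v₀ ≐ v₀ ∔ 𝐬· v₁ ⊃ ⊥̇)
  (⊃I (⊃E (ax (suc≢zero _)) (≐-sym (h₀ ⨾ +-suc _ _))))
  (⊃I (⊃E h₁ (⊃E (ax (suc-inj _ _)) (h₀ ⨾ suc-+ _ _)))))) t s)

-- Truncated subtraction

-- The second case expresses t < s without an existential quantifier: `s ∸̇ t` is a successor, and
-- its predecessor is written as `s ∸̇ 𝐬· t`.
Split : Tm Γ O → Tm Γ O → Fm Γ
Split s t = (s ≤₀ t ∧̇ t ≐ s ∔ (t ∸̇ s))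
  ∨̇ (t ∸̇ s ≐ num 0 ∧̇ s ∸̇ t ≐ 𝐬· (s ∸̇ 𝐬· t) ∧̇ s ≐ t ∔ (s ∸̇ t))

zero-∸ : (t : Tm Γ O) → Δ ⊩ num 0 ∸̇ t ≐ num 0
zero-∸ = spec₁ (ind (num 0 ∸̇ v₀ ≐ num 0) (conv _ _ refl)
  (conv _ (pred · (num 0 ∸̇ v₀)) refl ⨾ ≐-cong (pred · v₀) h₀ ⨾ conv _ _ refl))

suc-∸-suc : (s t : Tm Γ O) → Δ ⊩ 𝐬· s ∸̇ 𝐬· t ≐ s ∸̇ t
suc-∸-suc = spec₂ (∀I (ind (𝐬· v₁ ∸̇ 𝐬· v₀ ≐ v₁ ∸̇ v₀) (conv _ _ refl)
  (conv _ (pred · (𝐬· v₁ ∸̇ 𝐬· v₀)) refl ⨾ ≐-cong (pred · v₀) h₀ ⨾ conv _ _ refl)))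

split : (s t : Tm Γ O) → Δ ⊩ Split s t
split = spec₂ (ind (∀̇[ O ] Split v₁ v₀)
  (∀I (∨I₁ (∧I (zero-∸ v₀) (≐-sym (zero-+ _ ⨾ conv _ _ refl)))))
  -- This inner induction acts as a case distinction between zero and successor; the outer
  -- hypothesis, taken at the predecessor, settles the successor case.
  (ind (Split (𝐬· v₁) v₀)
    (∨I₂ (∧I (zero-∸ _) (∧I (conv _ _ refl) (≐-sym (zero-+ _ ⨾ conv _ _ refl)))))
    (∨E (∀E h₁ v₀)
      (∨I₁ (∧I (suc-∸-suc v₁ v₀ ⨾ ∧E₁ h₀)
        (𝐬-cong (∧E₂ h₀) ⨾ ≐-sym (suc-+ _ _) ⨾ +-cong ≐-rfl (≐-sym (suc-∸-suc v₀ v₁)))))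
      (∨I₂ (∧I (suc-∸-suc v₀ v₁ ⨾ ∧E₁ h₀) (∧I
        (suc-∸-suc v₁ v₀ ⨾ ∧E₁ (∧E₂ h₀) ⨾ 𝐬-cong (≐-sym (suc-∸-suc v₁ (𝐬· v₀))))
        (𝐬-cong (∧E₂ (∧E₂ h₀)) ⨾ ≐-sym (suc-+ _ _)
          ⨾ +-cong ≐-rfl (≐-sym (suc-∸-suc v₁ v₀)))))))))

-- Linear arithmetic

-- The difference is an explicit term rather than an existential witness inside the theory, so
-- inequalities are added and scaled by equational reasoning alone.
Leq : List (Fm Γ) → Tm Γ O → Tm Γ O → Set
Leq Δ s t = Σ (Tm _ O) λ d → Δ ⊩ t ≐ s ∔ d

≤₀⇒Leq : {s t : Tm Γ O} → Δ ⊩ s ≤₀ t → Leq Δ s t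
≤₀⇒Leq {s = s} {t} p = t ∸̇ s ,
  ∨E (split s t) (∧E₂ h₀)
    (⊥E (⊃E (ax (suc≢zero _)) (≐-sym (∧E₁ (∧E₂ h₀)) ⨾ wk p)))

Leq-resp : {s s′ t t′ : Tm Γ O} → Δ ⊩ s ≐ s′ → Δ ⊩ t ≐ t′ → Leq Δ s t → Leq Δ s′ t′
Leq-resp p q (d , r) = d , (≐-sym q ⨾ r ⨾ +-cong p ≐-rfl)

Leq-+ : {s s′ t t′ : Tm Γ O} → Leq Δ s t → Leq Δ s′ t′ → Leq Δ (s ∔ s′) (t ∔ t′)
Leq-+ (d , p) (e , q) = d ∔ e , (+-cong p q ⨾ interchange _ _ _ _)

infixl 6 _⊕_
infixl 7 _⊛_
data Lin (n : ℕ) : Set where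
  at  : Fin n → Lin n
  lit : ℕ → Lin n
  sc  : Lin n → Lin n
  _⊕_ : Lin n → Lin n → Lin n
  _⊛_ : ℕ → Lin n → Lin n

pattern x₀ = at zero
pattern x₁ = at (suc zero)
pattern x₂ = at (suc (suc zero))
pattern x₃ = at (suc (suc (suc zero)))
pattern x₄ = at (suc (suc (suc (suc zero))))
pattern x₅ = at (suc (suc (suc (suc (suc zero)))))
pattern x₆ = at (suc (suc (suc (suc (suc (suc zero))))))
pattern x₇ = at (suc (suc (suc (suc (suc (suc (suc zero)))))))
pattern x₈ = at (suc (suc (suc (suc (suc (suc (suc (suc zero))))))))
pattern x₉ = at (suc (suc (suc (suc (suc (suc (suc (suc (suc zero)))))))))
pattern x₁₀ = at (suc (suc (suc (suc (suc (suc (suc (suc (suc (suc zero))))))))))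
pattern x₁₁ = at (suc (suc (suc (suc (suc (suc (suc (suc (suc (suc (suc zero)))))))))))
pattern x₁₂ = at (suc (suc (suc (suc (suc (suc (suc (suc (suc (suc (suc (suc zero))))))))))))
pattern x₁₃ = at (suc (suc (suc (suc (suc (suc (suc (suc (suc (suc (suc (suc (suc zero)))))))))))))

Env : Cx → ℕ → Set
Env Γ n = Vec (Tm Γ O) n

variable
  n : ℕ
  η : Env Γ n

⟦_⟧ : Lin n → Env Γ n → Tm Γ O
⟦ at i ⟧  η = lookup η i
⟦ lit k ⟧ η = num k
⟦ sc e ⟧  η = 𝐬· (⟦ e ⟧ η)
⟦ d ⊕ e ⟧ η = ⟦ d ⟧ η ∔ ⟦ e ⟧ η
⟦ k ⊛ e ⟧ η = num k ∗ ⟦ e ⟧ η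

_×ₜ_ : ℕ → Tm Γ O → Tm Γ O
zero  ×ₜ t = num 0
suc k ×ₜ t = t ∔ k ×ₜ t

⟪_⟫ : Vec ℕ n → Env Γ n → Tm Γ O
⟪ [] ⟫    []      = num 0
⟪ k ∷ v ⟫ (t ∷ η) = k ×ₜ t ∔ ⟪ v ⟫ η

infixl 6 _⊞_
_⊞_ : Vec ℕ n → Vec ℕ n → Vec ℕ n
_⊞_ = zipWith ℕ._+_

𝟎 : Vec ℕ n
𝟎 = replicate _ 0

unit : Fin n → Vec ℕ n
unit zero    = 1 ∷ 𝟎
unit (suc i) = 0 ∷ unit i

scale : ℕ → Vec ℕ n → Vec ℕ n
scale zero    v = 𝟎
scale (suc k) v = v ⊞ scale k v

-- The constant term is the coefficient of an extra atom, num 1.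
coeffs : Lin n → Vec ℕ (suc n)
coeffs (at i)  = unit (suc i)
coeffs (lit k) = scale k (unit zero)
coeffs (sc e)  = unit zero ⊞ coeffs e
coeffs (d ⊕ e) = coeffs d ⊞ coeffs e
coeffs (k ⊛ e) = scale k (coeffs e)

×ₜ-+ : (k l : ℕ) (t : Tm Γ O) → Δ ⊩ (k ℕ.+ l) ×ₜ t ≐ k ×ₜ t ∔ l ×ₜ t
×ₜ-+ zero    l t = ≐-sym (zero-+ _)
×ₜ-+ (suc k) l t = +-cong ≐-rfl (×ₜ-+ k l t) ⨾ ≐-sym (+-assoc _ _ _)

⟪⟫-⊞ : (v w : Vec ℕ n) (η : Env Γ n) → Δ ⊩ ⟪ v ⊞ w ⟫ η ≐ ⟪ v ⟫ η ∔ ⟪ w ⟫ η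
⟪⟫-⊞ []      []      []      = ≐-sym (zero-+ _)
⟪⟫-⊞ (k ∷ v) (l ∷ w) (t ∷ η) = +-cong (×ₜ-+ k l t) (⟪⟫-⊞ v w η) ⨾ interchange _ _ _ _

⟪⟫-𝟎 : (η : Env Γ n) → Δ ⊩ ⟪ 𝟎 ⟫ η ≐ num 0
⟪⟫-𝟎 []      = ≐-rfl
⟪⟫-𝟎 (t ∷ η) = zero-+ _ ⨾ ⟪⟫-𝟎 η

⟪⟫-unit : (i : Fin n) (η : Env Γ n) → Δ ⊩ ⟪ unit i ⟫ η ≐ lookup η i
⟪⟫-unit zero    (t ∷ η) = +-cong (+-zero t) (⟪⟫-𝟎 η) ⨾ +-zero t
⟪⟫-unit (suc i) (t ∷ η) = zero-+ _ ⨾ ⟪⟫-unit i η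

⟪⟫-scale : (k : ℕ) (v : Vec ℕ n) (η : Env Γ n) → Δ ⊩ ⟪ scale k v ⟫ η ≐ num k ∗ ⟪ v ⟫ η
⟪⟫-scale zero    v η = ⟪⟫-𝟎 η ⨾ ≐-sym (zero-* _)
⟪⟫-scale (suc k) v η =
  ⟪⟫-⊞ v (scale k v) η ⨾ +-cong ≐-rfl (⟪⟫-scale k v η) ⨾ ≐-sym (suc-* _ _)

1+t : (t : Tm Γ O) → Δ ⊩ num 1 ∔ t ≐ 𝐬· t
1+t t = suc-+ _ t ⨾ 𝐬-cong (zero-+ t)

⟪⟫-const : (k : ℕ) (η : Env Γ n) → Δ ⊩ ⟪ scale k (unit zero) ⟫ (num 1 ∷ η) ≐ num k
⟪⟫-const zero    η = ⟪⟫-𝟎 (num 1 ∷ η)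
⟪⟫-const (suc k) η =
  ⟪⟫-⊞ (unit zero) (scale k (unit zero)) (num 1 ∷ η)
  ⨾ +-cong (⟪⟫-unit zero (num 1 ∷ η)) (⟪⟫-const k η) ⨾ 1+t _

*-cong : (k : Tm Γ O) {s t : Tm Γ O} → Δ ⊩ s ≐ t → Δ ⊩ k ∗ s ≐ k ∗ t
*-cong k {s} {t} p =
  cast (cong₂ (λ a b → a ∗ s ≐ b ∗ t) (↑-inst k s) (↑-inst k t)) (≐-cong (k ↑ ∗ v₀) p)

⟦⟧-coeffs : (e : Lin n) (η : Env Γ n) → Δ ⊩ ⟦ e ⟧ η ≐ ⟪ coeffs e ⟫ (num 1 ∷ η)
⟦⟧-coeffs (at i)  η = ≐-sym (⟪⟫-unit (suc i) (num 1 ∷ η))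
⟦⟧-coeffs (lit k) η = ≐-sym (⟪⟫-const k η)
⟦⟧-coeffs (sc e)  η =
  𝐬-cong (⟦⟧-coeffs e η) ⨾ ≐-sym (1+t _)
  ⨾ ≐-sym (⟪⟫-⊞ (unit zero) (coeffs e) (num 1 ∷ η) ⨾ +-cong (⟪⟫-unit zero (num 1 ∷ η)) ≐-rfl)
⟦⟧-coeffs (d ⊕ e) η =
  +-cong (⟦⟧-coeffs d η) (⟦⟧-coeffs e η) ⨾ ≐-sym (⟪⟫-⊞ (coeffs d) (coeffs e) (num 1 ∷ η))
⟦⟧-coeffs (k ⊛ e) η = *-cong (num k) (⟦⟧-coeffs e η) ⨾ ≐-sym (⟪⟫-scale k (coeffs e) (num 1 ∷ η))

record Fact (Δ : List (Fm Γ)) (η : Env Γ n) : Set where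
  constructor fact
  field
    lhs rhs : Lin n
    holds   : Leq Δ (⟦ lhs ⟧ η) (⟦ rhs ⟧ η)

open Fact

le≤ : (l r : Lin n) → Δ ⊩ ⟦ l ⟧ η ≤₀ ⟦ r ⟧ η → Fact Δ η
le≤ l r p = fact l r (≤₀⇒Leq p)

eq≤ : (l r : Lin n) → Δ ⊩ ⟦ l ⟧ η ≐ ⟦ r ⟧ η → Fact Δ η
eq≤ l r p = fact l r (num 0 , (≐-sym p ⨾ ≐-sym (+-zero _)))

eq≥ : (l r : Lin n) → Δ ⊩ ⟦ l ⟧ η ≐ ⟦ r ⟧ η → Fact Δ η
eq≥ l r p = eq≤ r l (≐-sym p)

-- Each fact comes with its multiplier, as in a Farkas certificate: the weighted sum of the facts
-- must be visibly contradictory once both sides are written as coefficient vectors.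
Facts : (Δ : List (Fm Γ)) → Env Γ n → Set
Facts Δ η = List (ℕ × Fact Δ η)

side : (Fact Δ η → Lin n) → Facts {n = n} Δ η → Vec ℕ (suc n)
side s []             = 𝟎
side s ((k , f) ∷ fs) = scale k (coeffs (s f)) ⊞ side s fs

Leq-scale : {v w : Vec ℕ n} (k : ℕ) → Leq Δ (⟪ v ⟫ η) (⟪ w ⟫ η) →
            Leq Δ (⟪ scale k v ⟫ η) (⟪ scale k w ⟫ η)
Leq-scale zero p = num 0 , ≐-sym (+-zero _)
Leq-scale {v = v} {w} (suc k) p =
  Leq-resp (≐-sym (⟪⟫-⊞ v _ _)) (≐-sym (⟪⟫-⊞ w _ _)) (Leq-+ p (Leq-scale {v = v} {w} k p))

Leq-coeffs : (l r : Lin n) → Leq Δ (⟦ l ⟧ η) (⟦ r ⟧ η) →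
             Leq Δ (⟪ coeffs l ⟫ (num 1 ∷ η)) (⟪ coeffs r ⟫ (num 1 ∷ η))
Leq-coeffs l r = Leq-resp (⟦⟧-coeffs l _) (⟦⟧-coeffs r _)

combine : (fs : Facts Δ η) → Leq Δ (⟪ side lhs fs ⟫ (num 1 ∷ η)) (⟪ side rhs fs ⟫ (num 1 ∷ η))
combine [] = num 0 , ≐-sym (+-zero _)
combine ((k , f) ∷ fs) =
  Leq-resp (≐-sym (⟪⟫-⊞ (scale k (coeffs (lhs f))) _ _))
    (≐-sym (⟪⟫-⊞ (scale k (coeffs (rhs f))) _ _))
    (Leq-+ (Leq-scale {v = coeffs (lhs f)} {coeffs (rhs f)} k (Leq-coeffs (lhs f) (rhs f)
      (holds f)))
      (combine fs))

_⊟_ : Vec ℕ n → Vec ℕ n → Vec ℕ n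
_⊟_ = zipWith ℕ._∸_

-- v exceeds w by at least one in the constant term and is at least w elsewhere.
Exceeds : Vec ℕ (suc n) → Vec ℕ (suc n) → Set
Exceeds v w = v ≡ w ⊞ (unit zero ⊞ (v ⊟ (w ⊞ unit zero)))

refute : {v w : Vec ℕ (suc n)} → Exceeds v w →
         Leq Δ (⟪ v ⟫ (num 1 ∷ η)) (⟪ w ⟫ (num 1 ∷ η)) → Δ ⊩ ⊥̇
refute {η = η} {v} {w} e (d , p) = n≢n+1+m (⟪ w ⟫ _) (⟪ x ⟫ _ ∔ d)
  (p ⨾ +-cong (cast (cong (λ a → ⟪ v ⟫ (num 1 ∷ η) ≐ ⟪ a ⟫ (num 1 ∷ η)) e) ≐-rfl
        ⨾ ⟪⟫-⊞ w _ _ ⨾ +-cong ≐-rfl (⟪⟫-⊞ (unit zero) x _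
           ⨾ +-cong (⟪⟫-unit zero (num 1 ∷ η)) ≐-rfl ⨾ 1+t _)) ≐-rfl
     ⨾ +-assoc _ _ _ ⨾ +-cong ≐-rfl (suc-+ _ _))
  where x = v ⊟ (w ⊞ unit zero)

lin-⊥ : (η : Env Γ n) (fs : Facts Δ η) → Exceeds (side lhs fs) (side rhs fs) → Δ ⊩ A
lin-⊥ η fs e = ⊥E (refute e (combine fs))

-- The negated goal is used with multiplicity k.
lin-≤ : (η : Env Γ n) (k : ℕ) (l r : Lin n) (fs : Facts Δ η) →
        Exceeds (scale k (coeffs (sc r)) ⊞ side lhs fs) (scale k (coeffs l) ⊞ side rhs fs) →
        Δ ⊩ ⟦ l ⟧ η ≤₀ ⟦ r ⟧ η
lin-≤ η k l r fs e = ∨E (split (⟦ l ⟧ η) (⟦ r ⟧ η)) (∧E₁ h₀)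
  (⊥E (refute e
    (Leq-resp (≐-sym (⟪⟫-⊞ (scale k (coeffs (sc r))) _ _)) (≐-sym (⟪⟫-⊞ (scale k (coeffs l)) _ _))
      (Leq-+
        (Leq-scale {v = coeffs (sc r)} {coeffs l} k (Leq-coeffs (sc r) l
          (_ , (∧E₂ (∧E₂ h₀) ⨾ +-cong ≐-rfl (∧E₁ (∧E₂ h₀)) ⨾ +-suc _ _ ⨾ ≐-sym (suc-+ _ _)))))
        (proj₁ (combine fs) , wk (proj₂ (combine fs)))))))

≤-antisym : {s t : Tm Γ O} → Δ ⊩ s ≤₀ t → Δ ⊩ t ≤₀ s → Δ ⊩ s ≐ t
≤-antisym {s = s} {t} p q =
  ∨E (split s t)
    (≐-sym (∧E₂ h₀ ⨾ +-cong ≐-rfl (wk q) ⨾ +-zero _))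
    (⊥E (⊃E (ax (suc≢zero _)) (≐-sym (∧E₁ (∧E₂ h₀)) ⨾ wk p)))

lin-≐ : (η : Env Γ n) (k : ℕ) (l r : Lin n) (fs gs : Facts Δ η) →
        Exceeds (scale k (coeffs (sc r)) ⊞ side lhs fs) (scale k (coeffs l) ⊞ side rhs fs) →
        Exceeds (scale k (coeffs (sc l)) ⊞ side lhs gs) (scale k (coeffs r) ⊞ side rhs gs) →
        Δ ⊩ ⟦ l ⟧ η ≐ ⟦ r ⟧ η
lin-≐ η k l r fs gs d e = ≤-antisym (lin-≤ η k l r fs d) (lin-≤ η k r l gs e)

record Equation (Δ : List (Fm Γ)) (η : Env Γ n) : Set where
  constructor equation
  field
    left right : Lin n
    proof      : Δ ⊩ ⟦ left ⟧ η ≐ ⟦ right ⟧ η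

Equations : (Δ : List (Fm Γ)) → Env Γ n → Set
Equations Δ η = List (ℕ × Equation Δ η)

forwards backwards : Equations Δ η → Facts Δ η
forwards  = map λ where (k , equation l r p) → k , eq≤ l r p
backwards = map λ where (k , equation l r p) → k , eq≥ l r p

-- Reversing every equation turns a certificate for one inequality into a certificate for the other,
-- so one list of multipliers serves both directions.
lin-= : (η : Env Γ n) (l r : Lin n) (es : Equations Δ η) →
        Exceeds (scale 1 (coeffs (sc r)) ⊞ side lhs (forwards es))
                (scale 1 (coeffs l) ⊞ side rhs (forwards es)) →
        Exceeds (scale 1 (coeffs (sc l)) ⊞ side lhs (backwards es))
                (scale 1 (coeffs r) ⊞ side rhs (backwards es)) →
        Δ ⊩ ⟦ l ⟧ η ≐ ⟦ r ⟧ η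
lin-= η l r es = lin-≐ η 1 l r (forwards es) (backwards es)

-- Case distinctions for comparison, minimum and digit choice

≤-cases : (s t : Tm Γ O) →
  Δ ⊩ (s ≤₀ t ∧̇ t ≐ s ∔ (t ∸̇ s)) ∨̇ (𝐬· t ≤₀ s ∧̇ s ≐ t ∔ (s ∸̇ t))
≤-cases s t = ∨E (split s t) (∨I₁ h₀)
  (∨I₂ (∧I
    (lin-≤ (s ∷ t ∷ (s ∸̇ t) ∷ (s ∸̇ 𝐬· t) ∷ []) 1 (sc x₁) x₀
      ((1 , eq≥ x₀ (x₁ ⊕ x₂) (∧E₂ (∧E₂ h₀))) ∷ (1 , eq≥ x₂ (sc x₃) (∧E₁ (∧E₂ h₀))) ∷ []) refl)
    (∧E₂ (∧E₂ h₀))))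

le-cases : (s t : Tm Γ O) →
  Δ ⊩ (s ≤₀ t ∧̇ le · s · t ≐ num 1) ∨̇ (𝐬· t ≤₀ s ∧̇ le · s · t ≐ num 0)
le-cases = spec₂ (∀I (∀I (∨E (≤-cases v₁ v₀)
  (∨I₁ (∧I (∧E₁ h₀)
    (conv (le · v₁ · v₀) (num 1 ∸̇ (v₁ ∸̇ v₀)) refl ⨾ ≐-cong (num 1 ∸̇ v₀) (∧E₁ h₀)
      ⨾ conv _ (num 1) refl)))
  (∨I₂ (∧I (∧E₁ h₀)
    (∨E (split v₁ v₀)
      (lin-⊥ (v₁ ∷ v₀ ∷ []) ((1 , le≤ (sc x₁) x₀ (∧E₁ h₁)) ∷ (1 , le≤ x₀ x₁ (∧E₁ h₀)) ∷ []) refl)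
      (conv (le · v₁ · v₀) (num 1 ∸̇ (v₁ ∸̇ v₀)) refl
        ⨾ ≐-cong (num 1 ∸̇ v₀) (∧E₁ (∧E₂ h₀)) ⨾ suc-∸-suc _ _ ⨾ zero-∸ _)))))))

min-cases : (s t : Tm Γ O) →
  Δ ⊩ (s ≤₀ t ∧̇ min₀ · s · t ≐ s) ∨̇ (t ≤₀ s ∧̇ min₀ · s · t ≐ t)
min-cases = spec₂ (∀I (∀I (∨E (≤-cases v₁ v₀)
  (∨I₁ (∧I (∧E₁ h₀)
    (conv (min₀ · v₁ · v₀) (v₁ ∸̇ (v₁ ∸̇ v₀)) refl ⨾ ≐-cong (v₂ ∸̇ v₀) (∧E₁ h₀) ⨾ conv _ _ refl)))
  (∨I₂ (∧I
    (lin-≤ (v₁ ∷ v₀ ∷ []) 1 x₁ x₀ ((1 , le≤ (sc x₁) x₀ (∧E₁ h₀)) ∷ []) refl)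
    (conv (min₀ · v₁ · v₀) (v₁ ∸̇ (v₁ ∸̇ v₀)) refl
      ⨾ ∨E (≤-cases v₁ (v₁ ∸̇ v₀))
          (lin-≐ (v₁ ∷ v₀ ∷ (v₁ ∸̇ v₀) ∷ (v₁ ∸̇ (v₁ ∸̇ v₀)) ∷ []) 1 x₃ x₁
            ((1 , eq≤ x₃ (lit 0) (∧E₁ h₀)) ∷ [])
            ((1 , eq≥ x₀ (x₁ ⊕ x₂) (∧E₂ h₁)) ∷ (1 , le≤ x₀ x₂ (∧E₁ h₀)) ∷ []) refl refl)
          (lin-≐ (v₁ ∷ v₀ ∷ (v₁ ∸̇ v₀) ∷ (v₁ ∸̇ (v₁ ∸̇ v₀)) ∷ []) 1 x₃ x₁
            ((1 , eq≥ x₀ (x₂ ⊕ x₃) (∧E₂ h₀)) ∷ (1 , eq≤ x₀ (x₁ ⊕ x₂) (∧E₂ h₁)) ∷ [])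
            ((1 , eq≤ x₀ (x₂ ⊕ x₃) (∧E₂ h₀)) ∷ (1 , eq≥ x₀ (x₁ ⊕ x₂) (∧E₂ h₁)) ∷ [])
            refl refl)))))))

digit-cases : (a c : Tm Γ O) → Δ ⊩
  (c ∔ num 4 ≤₀ a ∧̇ digit · a · c ≐ num 2)
  ∨̇ ((c ≤₀ a ∔ num 4 ∧̇ 𝐬· a ≤₀ c ∔ num 4) ∧̇ digit · a · c ≐ num 1)
  ∨̇ (𝐬· (a ∔ num 4) ≤₀ c ∧̇ digit · a · c ≐ num 0)
digit-cases = spec₂ (∀I (∀I (∨E (le-cases (v₀ ∔ num 4) v₁)
  (∨E (le-cases v₀ (v₁ ∔ num 4))
    (∨I₁ (∧I (∧E₁ h₁) (unfold ⨾ +-cong (∧E₂ h₁) (∧E₂ h₀) ⨾ conv _ (num 2) refl)))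
    (lin-⊥ (v₁ ∷ v₀ ∷ [])
      ((1 , le≤ (x₁ ⊕ lit 4) x₀ (∧E₁ h₁)) ∷ (1 , le≤ (sc (x₀ ⊕ lit 4)) x₁ (∧E₁ h₀)) ∷ []) refl))
  (∨E (le-cases v₀ (v₁ ∔ num 4))
    (∨I₂ (∨I₁ (∧I (∧I (∧E₁ h₀) (∧E₁ h₁)) (unfold ⨾ +-cong (∧E₂ h₁) (∧E₂ h₀)
      ⨾ conv _ (num 1) refl))))
    (∨I₂ (∨I₂ (∧I (∧E₁ h₀) (unfold ⨾ +-cong (∧E₂ h₁) (∧E₂ h₀) ⨾ conv _ (num 0) refl))))))))
  where
  unfold : {Δ : List (Fm (O ∷ O ∷ Γ))} →
    Δ ⊩ digit · v₁ · v₀ ≐ le · (v₀ ∔ num 4) · v₁ ∔ le · v₀ · (v₁ ∔ num 4)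
  unfold = conv _ _ refl

-- Signed digit expansions

pos-zero : (γ : Tm Γ 𝟏) → Δ ⊩ pos · γ · num 0 ≐ γ · num 0
pos-zero = spec₁ (∀I (conv (pos · v₀ · num 0) (v₀ · num 0) refl))

pos-suc : (γ : Tm Γ 𝟏) (n : Tm Γ O) →
  Δ ⊩ pos · γ · 𝐬· n ≐ num 2 ∗ (pos · γ · n) ∔ min₀ · (γ · 𝐬· (𝐬· n)) · num 2
pos-suc = spec₂ (∀I (∀I (conv (pos · v₁ · 𝐬· v₀)
  (num 2 ∗ (pos · v₁ · v₀) ∔ min₀ · (v₁ · 𝐬· (𝐬· v₀)) · num 2) refl)))

neg-zero : (γ : Tm Γ 𝟏) → Δ ⊩ neg · γ · num 0 ≐ γ · num 1
neg-zero = spec₁ (∀I (conv (neg · v₀ · num 0) (v₀ · num 1) refl))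

neg-suc : (γ : Tm Γ 𝟏) (n : Tm Γ O) → Δ ⊩ neg · γ · 𝐬· n ≐ 𝐬· (num 2 ∗ (neg · γ · n))
neg-suc = spec₂ (∀I (∀I (conv (neg · v₁ · 𝐬· v₀) (𝐬· (num 2 ∗ (neg · v₁ · v₀))) refl)))

pos-suc-≥ : (γ : Tm Γ 𝟏) (n : Tm Γ O) → Δ ⊩ num 2 ∗ (pos · γ · n) ≤₀ pos · γ · 𝐬· n
pos-suc-≥ γ n = lin-≤ (pos · γ · n ∷ pos · γ · 𝐬· n ∷ min₀ · (γ · 𝐬· (𝐬· n)) · num 2 ∷ []) 1
  (2 ⊛ x₀) x₁ ((1 , eq≥ x₁ (2 ⊛ x₀ ⊕ x₂) (pos-suc γ n)) ∷ []) refl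

pos-suc-≤ : (γ : Tm Γ 𝟏) (n : Tm Γ O) → Δ ⊩ pos · γ · 𝐬· n ≤₀ num 2 ∗ (pos · γ · n) ∔ num 2
pos-suc-≤ γ n = ∨E (min-cases d (num 2))
  (lin-≤ ε 1 x₁ (2 ⊛ x₀ ⊕ lit 2)
    ((1 , eq≤ x₁ (2 ⊛ x₀ ⊕ x₂) (pos-suc γ n)) ∷ (1 , eq≤ x₂ x₃ (∧E₂ h₀))
      ∷ (1 , le≤ x₃ (lit 2) (∧E₁ h₀)) ∷ []) refl)
  (lin-≤ ε 1 x₁ (2 ⊛ x₀ ⊕ lit 2)
    ((1 , eq≤ x₁ (2 ⊛ x₀ ⊕ x₂) (pos-suc γ n)) ∷ (1 , eq≤ x₂ (lit 2) (∧E₂ h₀)) ∷ []) refl)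
  where
  d = γ · 𝐬· (𝐬· n)
  ε = pos · γ · n ∷ pos · γ · 𝐬· n ∷ min₀ · d · num 2 ∷ d ∷ []

-- Normalisation to signed digits

module _ (p q : Tm Γ 𝟏) where

  T⁻-zero : Δ ⊩ T⁻ · q · num 0 ≐ q · num 0
  T⁻-zero = spec₁ (∀I (conv (T⁻ · v₀ · num 0) (v₀ · num 0) refl)) q

  T⁺-zero : Δ ⊩ T⁺ · p · q · num 0 ≐ p · num 0
  T⁺-zero = spec₂ (∀I (∀I (conv (T⁺ · v₁ · v₀ · num 0) (v₁ · num 0) refl))) p q

  T⁻-suc : (n : Tm Γ O) → Δ ⊩ T⁻ · q · 𝐬· n ≐ num 2 ∗ 𝐬· (T⁻ · q · n)
  T⁻-suc = spec₂ (∀I (∀I (conv (T⁻ · v₁ · 𝐬· v₀) (num 2 ∗ 𝐬· (T⁻ · v₁ · v₀)) refl))) q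

  T⁺-suc : (n : Tm Γ O) → Δ ⊩ T⁺ · p · q · 𝐬· n ≐ num 2 ∗ (T⁺ · p · q · n ∔ digits · p · q · n)
  T⁺-suc = spec₃ (∀I (∀I (∀I (conv (T⁺ · v₂ · v₁ · 𝐬· v₀)
    (num 2 ∗ (T⁺ · v₂ · v₁ · v₀ ∔ digits · v₂ · v₁ · v₀)) refl)))) p q

  norm-zero : Δ ⊩ norm · p · q · num 0 ≐ p · num 0 ∔ digits · p · q · num 0 ∸̇ 𝐬· (q · num 0)
  norm-zero = spec₂ (∀I (∀I (conv (norm · v₁ · v₀ · num 0)
    (v₁ · num 0 ∔ digits · v₁ · v₀ · num 0 ∸̇ 𝐬· (v₀ · num 0)) refl))) p q

  norm-one : Δ ⊩ norm · p · q · num 1 ≐ 𝐬· (q · num 0) ∸̇ (p · num 0 ∔ digits · p · q · num 0)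
  norm-one = spec₂ (∀I (∀I (conv (norm · v₁ · v₀ · num 1)
    (𝐬· (v₀ · num 0) ∸̇ (v₁ · num 0 ∔ digits · v₁ · v₀ · num 0)) refl))) p q

  -- The digit with index 0 has gone into the integer part, whence the shift by one.
  norm-digit : (n : Tm Γ O) → Δ ⊩ norm · p · q · 𝐬· (𝐬· n) ≐ digits · p · q · 𝐬· n
  norm-digit = spec₃ (∀I (∀I (∀I (conv (norm · v₂ · v₁ · 𝐬· (𝐬· v₀))
    (digits · v₂ · v₁ · 𝐬· v₀) refl)))) p q

  digits-def : (n : Tm Γ O) →
    Δ ⊩ digits · p · q · n ≐ nextDigit p q n (T⁺ · p · q · n) (T⁻ · q · n)
  digits-def = spec₃ (∀I (∀I (∀I (conv (digits · v₂ · v₁ · v₀)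
    (nextDigit v₂ v₁ v₀ (T⁺ · v₂ · v₁ · v₀) (T⁻ · v₁ · v₀)) refl)))) p q

DigitCases : (a c e : Tm Γ O) → Fm Γ
DigitCases a c e =
  (c ∔ num 4 ≤₀ a ∧̇ e ≐ num 2)
  ∨̇ ((c ≤₀ a ∔ num 4 ∧̇ 𝐬· a ≤₀ c ∔ num 4) ∧̇ e ≐ num 1)
  ∨̇ (𝐬· (a ∔ num 4) ≤₀ c ∧̇ e ≐ num 0)

digits-cases : (p q : Tm Γ 𝟏) (n : Tm Γ O) →
  Δ ⊩ DigitCases (p · (n ∔ num 3) ∔ num 8 ∗ (T⁻ · q · n))
                 (q · (n ∔ num 3) ∔ num 8 ∗ (T⁺ · p · q · n)) (digits · p · q · n)
digits-cases p q n = ∨E (digit-cases _ _)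
  (∨I₁ (∧I (∧E₁ h₀) (digits-def p q n ⨾ ∧E₂ h₀)))
  (∨E h₀
    (∨I₂ (∨I₁ (∧I (∧E₁ h₀) (digits-def p q n ⨾ ∧E₂ h₀))))
    (∨I₂ (∨I₂ (∧I (∧E₁ h₀) (digits-def p q n ⨾ ∧E₂ h₀)))))

digits≤2 : (p q : Tm Γ 𝟏) (n : Tm Γ O) → Δ ⊩ digits · p · q · n ≤₀ num 2
digits≤2 p q n = ∨E (digits-cases p q n)
  (lin-≤ ε 1 x₀ (lit 2) ((1 , eq≤ x₀ (lit 2) (∧E₂ h₀)) ∷ []) refl)
  (∨E h₀
    (lin-≤ ε 1 x₀ (lit 2) ((1 , eq≤ x₀ (lit 1) (∧E₂ h₀)) ∷ []) refl)
    (lin-≤ ε 1 x₀ (lit 2) ((1 , eq≤ x₀ (lit 0) (∧E₂ h₀)) ∷ []) refl))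
  where
  ε = digits · p · q · n ∷ []

-- `pos` reads its argument through a cut-off at 2, which leaves these digits unchanged because they
-- never exceed 2.
norm-digit-min : (p q : Tm Γ 𝟏) (n : Tm Γ O) →
  Δ ⊩ min₀ · (norm · p · q · 𝐬· (𝐬· n)) · num 2 ≐ digits · p · q · 𝐬· n
norm-digit-min p q n = ∨E (min-cases _ _)
  (∧E₂ h₀ ⨾ norm-digit p q n)
  (≤-antisym
    (lin-≤ ε 1 x₀ x₂ ((1 , eq≤ x₀ (lit 2) (∧E₂ h₀)) ∷ (1 , le≤ (lit 2) x₁ (∧E₁ h₀))
      ∷ (1 , eq≤ x₁ x₂ (norm-digit p q n)) ∷ []) refl)
    (lin-≤ ε 1 x₂ x₀ ((1 , eq≥ x₀ (lit 2) (∧E₂ h₀))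
      ∷ (1 , le≤ x₂ (lit 2) (digits≤2 p q (𝐬· n))) ∷ []) refl))
  where
  ε = min₀ · (norm · p · q · 𝐬· (𝐬· n)) · num 2 ∷ norm · p · q · 𝐬· (𝐬· n) ∷ digits · p · q · 𝐬· n
    ∷ []

-- The n-th partial sum of norm · p · q is Tₙ + (eₙ − 1), written without subtraction.
norm-partial : (p q : Tm Γ 𝟏) (n : Tm Γ O) →
  Δ ⊩ pos · (norm · p · q) · n ∔ T⁻ · q · n ∔ num 1
      ≐ neg · (norm · p · q) · n ∔ T⁺ · p · q · n ∔ digits · p · q · n
norm-partial = spec₃ (∀I (∀I (ind
  (pos · (norm · v₂ · v₁) · v₀ ∔ T⁻ · v₁ · v₀ ∔ num 1
    ≐ neg · (norm · v₂ · v₁) · v₀ ∔ T⁺ · v₂ · v₁ · v₀ ∔ digits · v₂ · v₁ · v₀)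
  (initial v₁ v₀) (step v₂ v₁ v₀ h₀))))
  where
  initial : (p q : Tm Γ 𝟏) → Δ ⊩ pos · (norm · p · q) · num 0 ∔ T⁻ · q · num 0 ∔ num 1
    ≐ neg · (norm · p · q) · num 0 ∔ T⁺ · p · q · num 0 ∔ digits · p · q · num 0
  -- The integer part is stored as the two truncated differences of `s` and `t`; `split` tells which
  -- of them is zero.
  initial p q = ∨E (split s t)
    (lin-= ε goalˡ goalʳ
      ((1 , equation x₀ x₇ p₀) ∷ (1 , equation x₇ (lit 0) (∧E₁ h₀))
        ∷ (1 , equation x₈ x₁ (≐-sym q₀))
        ∷ (1 , equation x₂ x₆ (T⁻-zero p q)) ∷ (1 , equation x₅ x₃ (≐-sym (T⁺-zero p q)))
        ∷ (1 , equation (sc x₆) (x₅ ⊕ x₄ ⊕ x₈) (∧E₂ h₀)) ∷ []) refl refl)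
    (lin-= ε goalˡ goalʳ
      ((1 , equation x₀ x₇ p₀) ∷ (1 , equation (lit 0) x₈ (≐-sym (∧E₁ h₀)))
        ∷ (1 , equation x₈ x₁ (≐-sym q₀))
        ∷ (1 , equation x₂ x₆ (T⁻-zero p q)) ∷ (1 , equation x₅ x₃ (≐-sym (T⁺-zero p q)))
        ∷ (1 , equation (sc x₆ ⊕ x₇) (x₅ ⊕ x₄) (≐-sym (∧E₂ (∧E₂ h₀)))) ∷ []) refl refl)
    where
    s = p · num 0 ∔ digits · p · q · num 0
    t = 𝐬· (q · num 0)
    ε = pos · (norm · p · q) · num 0 ∷ neg · (norm · p · q) · num 0 ∷ T⁻ · q · num 0
      ∷ T⁺ · p · q · num 0
      ∷ digits · p · q · num 0 ∷ p · num 0 ∷ q · num 0 ∷ s ∸̇ t ∷ t ∸̇ s ∷ []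
    goalˡ = x₀ ⊕ x₂ ⊕ lit 1
    goalʳ = x₁ ⊕ x₃ ⊕ x₄
    p₀ : ∀ {Δ} → Δ ⊩ pos · (norm · p · q) · num 0 ≐ s ∸̇ t
    p₀ = pos-zero _ ⨾ norm-zero p q
    q₀ : ∀ {Δ} → Δ ⊩ neg · (norm · p · q) · num 0 ≐ t ∸̇ s
    q₀ = neg-zero _ ⨾ norm-one p q
  step : (p q : Tm Γ 𝟏) (n : Tm Γ O) →
    Δ ⊩ pos · (norm · p · q) · n ∔ T⁻ · q · n ∔ num 1
      ≐ neg · (norm · p · q) · n ∔ T⁺ · p · q · n ∔ digits · p · q · n →
    Δ ⊩ pos · (norm · p · q) · 𝐬· n ∔ T⁻ · q · 𝐬· n ∔ num 1
      ≐ neg · (norm · p · q) · 𝐬· n ∔ T⁺ · p · q · 𝐬· n ∔ digits · p · q · 𝐬· n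
  step p q n ih = lin-=
    (pos · (norm · p · q) · n ∷ pos · (norm · p · q) · 𝐬· n ∷ neg · (norm · p · q) · n
      ∷ neg · (norm · p · q) · 𝐬· n
      ∷ T⁻ · q · n ∷ T⁻ · q · 𝐬· n ∷ T⁺ · p · q · n ∷ T⁺ · p · q · 𝐬· n
      ∷ digits · p · q · n ∷ digits · p · q · 𝐬· n ∷ min₀ · (norm · p · q · 𝐬· (𝐬· n)) · num 2 ∷ [])
    (x₁ ⊕ x₅ ⊕ lit 1) (x₃ ⊕ x₇ ⊕ x₉)
    ((1 , equation x₁ (2 ⊛ x₀ ⊕ x₁₀) (pos-suc _ n))
      ∷ (1 , equation (sc (2 ⊛ x₂)) x₃ (≐-sym (neg-suc _ n)))
      ∷ (1 , equation x₅ (2 ⊛ sc x₄) (T⁻-suc p q n))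
      ∷ (1 , equation (2 ⊛ (x₆ ⊕ x₈)) x₇ (≐-sym (T⁺-suc p q n)))
      ∷ (1 , equation x₁₀ x₉ (norm-digit-min p q n))
      ∷ (2 , equation (x₀ ⊕ x₄ ⊕ lit 1) (x₂ ⊕ x₆ ⊕ x₈) ih) ∷ []) refl refl

-- With P = p − q, these say Pₙ₊₁ ≥ 2 Pₙ − 2 and Pₙ₊₁ ≤ 2 Pₙ + 2.
LowStep HighStep : Tm Γ 𝟏 → Tm Γ 𝟏 → Tm Γ O → Fm Γ
LowStep  p q n = num 2 ∗ (p · n) ∔ q · 𝐬· n ≤₀ p · 𝐬· n ∔ num 2 ∗ (q · n) ∔ num 2
HighStep p q n = p · 𝐬· n ∔ num 2 ∗ (q · n) ≤₀ num 2 ∗ (p · n) ∔ q · 𝐬· n ∔ num 2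

shift : (p : Tm Γ 𝟏) (n : Tm Γ O) → Δ ⊩ p · (𝐬· n ∔ num 3) ≐ p · 𝐬· (n ∔ num 3)
shift = spec₂ (∀I (∀I (conv (v₁ · (𝐬· v₀ ∔ num 3)) (v₁ · 𝐬· (v₀ ∔ num 3)) refl)))

+3 : (p : Tm Γ 𝟏) (n : Tm Γ O) → Δ ⊩ p · (n ∔ num 3) ≐ p · 𝐬· (𝐬· (𝐬· n))
+3 = spec₂ (∀I (∀I (conv (v₁ · (v₀ ∔ num 3)) (v₁ · 𝐬· (𝐬· (𝐬· v₀))) refl)))

-- With P = p − q, T = T⁺ − T⁻ and D = Pₙ₊₃ − 8 Tₙ, this is D ≥ −14.  A step
-- doubles D and changes it by at most 2, and if D < −4 the digit −1 adds 16.
Invariant : (p q : Tm Γ 𝟏) (n : Tm Γ O) → Fm Γ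
Invariant p q n =
  q · (n ∔ num 3) ∔ num 8 ∗ (T⁺ · p · q · n)
  ≤₀ p · (n ∔ num 3) ∔ num 8 ∗ (T⁻ · q · n) ∔ num 14

-- Three steps from P₀ to P₃ lose 2 each, with weights 4, 2 and 1. This is the origin of 14 = 8 + 4
-- + 2.
invariant-zero : (p q : Tm Γ 𝟏) →
  Δ ⊩ LowStep p q (num 0) → Δ ⊩ LowStep p q (num 1) → Δ ⊩ LowStep p q (num 2) →
  Δ ⊩ Invariant p q (num 0)
invariant-zero p q l₀ l₁ l₂ = lin-≤
  (p · num 0 ∷ p · num 1 ∷ p · num 2 ∷ p · num 3 ∷ q · num 0 ∷ q · num 1 ∷ q · num 2 ∷ q · num 3
    ∷ T⁺ · p · q · num 0 ∷ T⁻ · q · num 0 ∷ p · (num 0 ∔ num 3) ∷ q · (num 0 ∔ num 3) ∷ [])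
  1 (x₁₁ ⊕ 8 ⊛ x₈) (x₁₀ ⊕ 8 ⊛ x₉ ⊕ lit 14)
  ((1 , eq≤ x₁₁ x₇ (+3 q _)) ∷ (1 , eq≥ x₁₀ x₃ (+3 p _)) ∷ (8 , eq≤ x₈ x₀ (T⁺-zero p q))
    ∷ (8 , eq≥ x₉ x₄ (T⁻-zero p q))
    ∷ (4 , le≤ (2 ⊛ x₀ ⊕ x₅) (x₁ ⊕ 2 ⊛ x₄ ⊕ lit 2) l₀)
    ∷ (2 , le≤ (2 ⊛ x₁ ⊕ x₆) (x₂ ⊕ 2 ⊛ x₅ ⊕ lit 2) l₁)
    ∷ (1 , le≤ (2 ⊛ x₂ ⊕ x₇) (x₃ ⊕ 2 ⊛ x₆ ⊕ lit 2) l₂) ∷ []) refl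

-- The new value of D is at least 2D - 2 - 16(e - 1). For e = 2 and e = 1 the choice of the digit
-- gives D ≥ 4 and D ≥ -4, hence -10 in both cases; for e = 0 the old bound -14 reproduces itself,
-- as 2·(-14) - 2 + 16 = -14.
invariant-suc : (p q : Tm Γ 𝟏) (n : Tm Γ O) →
  Δ ⊩ LowStep p q (n ∔ num 3) → Δ ⊩ Invariant p q n → Δ ⊩ Invariant p q (𝐬· n)
invariant-suc {Γ = Γ} p q n l i = ∨E (digits-cases p q n)
  (goal ((2 , le≤ (x₃ ⊕ 8 ⊛ x₀ ⊕ lit 4) (x₂ ⊕ 8 ⊛ x₁) (∧E₁ h₀))
    ∷ (16 , eq≤ x₈ (lit 2) (∧E₂ h₀)) ∷ com l) refl)
  (∨E h₀
    (goal ((2 , le≤ (x₃ ⊕ 8 ⊛ x₀) (x₂ ⊕ 8 ⊛ x₁ ⊕ lit 4) (∧E₁ (∧E₁ h₀)))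
      ∷ (16 , eq≤ x₈ (lit 1) (∧E₂ h₀)) ∷ com (wk l)) refl)
    (goal ((2 , le≤ (x₃ ⊕ 8 ⊛ x₀) (x₂ ⊕ 8 ⊛ x₁ ⊕ lit 14) (wk (wk i)))
      ∷ (16 , eq≤ x₈ (lit 0) (∧E₂ h₀)) ∷ com (wk l)) refl))
  where
  ε : Env Γ 9
  ε = T⁺ · p · q · n ∷ T⁻ · q · n ∷ p · (n ∔ num 3) ∷ q · (n ∔ num 3) ∷ p · 𝐬· (n ∔ num 3)
    ∷ q · 𝐬· (n ∔ num 3)
    ∷ T⁺ · p · q · 𝐬· n ∷ T⁻ · q · 𝐬· n ∷ digits · p · q · n ∷ []
  goal : ∀ {Δ} (fs : Facts Δ ε) → _ → Δ ⊩ Invariant p q (𝐬· n)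
  goal fs e = lin-≤ (p · (𝐬· n ∔ num 3) ∷ q · (𝐬· n ∔ num 3) ∷ p · 𝐬· (n ∔ num 3)
    ∷ q · 𝐬· (n ∔ num 3) ∷ T⁺ · p · q · 𝐬· n ∷ T⁻ · q · 𝐬· n ∷ [])
    1 (x₁ ⊕ 8 ⊛ x₄) (x₀ ⊕ 8 ⊛ x₅ ⊕ lit 14)
    ((1 , eq≥ x₀ x₂ (shift p n)) ∷ (1 , eq≤ x₁ x₃ (shift q n))
      ∷ (1 , le≤ (x₃ ⊕ 8 ⊛ x₄) (x₂ ⊕ 8 ⊛ x₅ ⊕ lit 14) (lin-≤ ε 1 (x₅ ⊕ 8 ⊛ x₆)
      (x₄ ⊕ 8 ⊛ x₇ ⊕ lit 14) fs e)) ∷ []) refl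
  com : ∀ {Δ A} → Δ ⊩ LowStep p q (n ∔ num 3) → Facts (A ∷ Δ) ε
  com l = (1 , le≤ (2 ⊛ x₂ ⊕ x₅) (x₄ ⊕ 2 ⊛ x₃ ⊕ lit 2) (wk l))
    ∷ (8 , eq≤ x₆ (2 ⊛ (x₀ ⊕ x₈)) (T⁺-suc p q n))
    ∷ (8 , eq≥ x₇ (2 ⊛ sc x₁) (T⁻-suc p q n)) ∷ []

UpperBound : (γ p q : Tm Γ 𝟏) (n : Tm Γ O) → Fm Γ
UpperBound γ p q n = pos · γ · n ∔ q · n ≤₀ neg · γ · n ∔ p · n ∔ num 2

-- Let A be the n-th partial sum of `norm · p · q`. Since Tₙ₊₁ = 2A, the invariant at n + 1 says 16A
-- ≤ Pₙ₊₄ + 14, and four high steps give Pₙ₊₄ ≤ 16Pₙ + 30. So 16A ≤ 16Pₙ + 44, and because 44 < 48,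
-- integrality yields A ≤ Pₙ + 2. The multiplier 16 of the negated goal does this rounding.
norm-upper-at : (p q : Tm Γ 𝟏) (n : Tm Γ O) → Δ ⊩ Invariant p q (𝐬· n) →
  Δ ⊩ HighStep p q n → Δ ⊩ HighStep p q (𝐬· n) → Δ ⊩ HighStep p q (𝐬· (𝐬· n)) →
  Δ ⊩ HighStep p q (𝐬· (𝐬· (𝐬· n))) → Δ ⊩ UpperBound (norm · p · q) p q n
norm-upper-at {Γ = Γ} p q n i s₀ s₁ s₂ s₃ = lin-≤ ε₁ 16 (x₁ ⊕ x₃) (x₂ ⊕ x₀ ⊕ lit 2)
  ((1 , le≤ (x₄ ⊕ 16 ⊛ x₇ ⊕ 16 ⊛ x₈) (x₅ ⊕ 16 ⊛ x₆ ⊕ lit 30) invariant)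
    ∷ (1 , le≤ (x₅ ⊕ 16 ⊛ x₃) (16 ⊛ x₀ ⊕ x₄ ⊕ lit 30) steps)
    ∷ (16 , eq≤ (x₁ ⊕ x₆ ⊕ lit 1) (x₂ ⊕ x₇ ⊕ x₈) (norm-partial p q n)) ∷ []) refl
  where
  n₁ n₂ n₃ n₄ : Tm Γ O
  n₁ = 𝐬· n
  n₂ = 𝐬· n₁
  n₃ = 𝐬· n₂
  n₄ = 𝐬· n₃
  ε₁ : Env Γ 9
  ε₁ = p · n ∷ pos · (norm · p · q) · n ∷ neg · (norm · p · q) · n ∷ q · n ∷ q · n₄ ∷ p · n₄
    ∷ T⁻ · q · n ∷ T⁺ · p · q · n ∷ digits · p · q · n ∷ []
  invariant : _ ⊩ q · n₄ ∔ num 16 ∗ (T⁺ · p · q · n) ∔ num 16 ∗ (digits · p · q · n)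
                ≤₀ p · n₄ ∔ num 16 ∗ (T⁻ · q · n) ∔ num 30
  invariant = lin-≤
    (p · n₄ ∷ q · n₄ ∷ p · (n₁ ∔ num 3) ∷ q · (n₁ ∔ num 3) ∷ T⁺ · p · q · n ∷ T⁻ · q · n
      ∷ T⁺ · p · q · n₁ ∷ T⁻ · q · n₁
      ∷ digits · p · q · n ∷ [])
    1 (x₁ ⊕ 16 ⊛ x₄ ⊕ 16 ⊛ x₈) (x₀ ⊕ 16 ⊛ x₅ ⊕ lit 30)
    ((1 , le≤ (x₃ ⊕ 8 ⊛ x₆) (x₂ ⊕ 8 ⊛ x₇ ⊕ lit 14) i) ∷ (1 , eq≤ x₂ x₀ (+3 p n₁))
      ∷ (1 , eq≥ x₃ x₁ (+3 q n₁))
      ∷ (8 , eq≥ x₆ (2 ⊛ (x₄ ⊕ x₈)) (T⁺-suc p q n))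
      ∷ (8 , eq≤ x₇ (2 ⊛ sc x₅) (T⁻-suc p q n)) ∷ []) refl
  steps : _ ⊩ p · n₄ ∔ num 16 ∗ (q · n) ≤₀ num 16 ∗ (p · n) ∔ q · n₄ ∔ num 30
  steps = lin-≤
    (p · n ∷ p · n₁ ∷ p · n₂ ∷ p · n₃ ∷ p · n₄ ∷ q · n ∷ q · n₁ ∷ q · n₂ ∷ q · n₃ ∷ q · n₄ ∷ [])
    1 (x₄ ⊕ 16 ⊛ x₅) (16 ⊛ x₀ ⊕ x₉ ⊕ lit 30)
    ((8 , le≤ (x₁ ⊕ 2 ⊛ x₅) (2 ⊛ x₀ ⊕ x₆ ⊕ lit 2) s₀)
      ∷ (4 , le≤ (x₂ ⊕ 2 ⊛ x₆) (2 ⊛ x₁ ⊕ x₇ ⊕ lit 2) s₁)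
      ∷ (2 , le≤ (x₃ ⊕ 2 ⊛ x₇) (2 ⊛ x₂ ⊕ x₈ ⊕ lit 2) s₂)
      ∷ (1 , le≤ (x₄ ⊕ 2 ⊛ x₈) (2 ⊛ x₃ ⊕ x₉ ⊕ lit 2) s₃) ∷ []) refl

norm-upper : {Δ : List (Fm Γ)} → Δ ⊩ ∀̇[ 𝟏 ] ∀̇[ 𝟏 ]
  ((∀̇[ O ] LowStep v₂ v₁ v₀) ⊃ (∀̇[ O ] HighStep v₂ v₁ v₀) ⊃ (∀̇[ O ] UpperBound (norm · v₂ · v₁) v₂ v₁ v₀))
norm-upper = ∀I (∀I (⊃I (⊃I (cut
  (ind (Invariant v₂ v₁ v₀)
    (invariant-zero v₁ v₀ (∀E h₁ (num 0)) (∀E h₁ (num 1)) (∀E h₁ (num 2)))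
    (invariant-suc v₂ v₁ v₀ (∀E h₂ (v₀ ∔ num 3)) h₀))
  (∀I (norm-upper-at v₂ v₁ v₀ (∀E h₀ (𝐬· v₀))
    (∀E h₁ v₀) (∀E h₁ (𝐬· v₀)) (∀E h₁ (𝐬· (𝐬· v₀))) (∀E h₁ (𝐬· (𝐬· (𝐬· v₀))))))))))

-- Upper bound for a sum of two reals

pos∔pos neg∔neg : Tm Γ 𝟏 → Tm Γ 𝟏 → Tm Γ 𝟏
pos∔pos x y = sum · (pos · x) · (pos · y)
neg∔neg x y = sum · (neg · x) · (neg · y)

sum-at : (p q : Tm Γ 𝟏) (n : Tm Γ O) → Δ ⊩ sum · p · q · n ≐ p · n ∔ q · n
sum-at = spec₃ (∀I (∀I (∀I (conv (sum · v₂ · v₁ · v₀) (v₂ · v₀ ∔ v₁ · v₀) refl))))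

module _ {Γ : Cx} (x y : Tm Γ 𝟏) (n : Tm Γ O) where

  private
    ε : Env Γ 12
    ε = pos · x · n ∷ pos · x · 𝐬· n ∷ pos · y · n ∷ pos · y · 𝐬· n
      ∷ neg · x · n ∷ neg · x · 𝐬· n ∷ neg · y · n ∷ neg · y · 𝐬· n
      ∷ pos∔pos x y · n ∷ pos∔pos x y · 𝐬· n ∷ neg∔neg x y · n ∷ neg∔neg x y · 𝐬· n ∷ []

  -- Each summand contributes one digit between -1 and 1, so together they deviate from doubling by
  -- at most 2.
  sum-low : Δ ⊩ LowStep (pos∔pos x y) (neg∔neg x y) n
  sum-low = lin-≤ ε 1 (2 ⊛ x₈ ⊕ x₁₁) (x₉ ⊕ 2 ⊛ x₁₀ ⊕ lit 2)
    ((2 , eq≤ x₈ (x₀ ⊕ x₂) (sum-at _ _ n)) ∷ (1 , eq≥ x₉ (x₁ ⊕ x₃) (sum-at _ _ (𝐬· n)))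
      ∷ (2 , eq≥ x₁₀ (x₄ ⊕ x₆) (sum-at _ _ n)) ∷ (1 , eq≤ x₁₁ (x₅ ⊕ x₇) (sum-at _ _ (𝐬· n)))
      ∷ (1 , le≤ (2 ⊛ x₀) x₁ (pos-suc-≥ x n)) ∷ (1 , le≤ (2 ⊛ x₂) x₃ (pos-suc-≥ y n))
      ∷ (1 , eq≤ x₅ (sc (2 ⊛ x₄)) (neg-suc x n))
      ∷ (1 , eq≤ x₇ (sc (2 ⊛ x₆)) (neg-suc y n)) ∷ []) refl

  sum-high : Δ ⊩ HighStep (pos∔pos x y) (neg∔neg x y) n
  sum-high = lin-≤ ε 1 (x₉ ⊕ 2 ⊛ x₁₀) (2 ⊛ x₈ ⊕ x₁₁ ⊕ lit 2)
    ((2 , eq≥ x₈ (x₀ ⊕ x₂) (sum-at _ _ n)) ∷ (1 , eq≤ x₉ (x₁ ⊕ x₃) (sum-at _ _ (𝐬· n)))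
      ∷ (2 , eq≤ x₁₀ (x₄ ⊕ x₆) (sum-at _ _ n)) ∷ (1 , eq≥ x₁₁ (x₅ ⊕ x₇) (sum-at _ _ (𝐬· n)))
      ∷ (1 , le≤ x₁ (2 ⊛ x₀ ⊕ lit 2) (pos-suc-≤ x n))
      ∷ (1 , le≤ x₃ (2 ⊛ x₂ ⊕ lit 2) (pos-suc-≤ y n))
      ∷ (1 , eq≥ x₅ (sc (2 ⊛ x₄)) (neg-suc x n))
      ∷ (1 , eq≥ x₇ (sc (2 ⊛ x₆)) (neg-suc y n)) ∷ []) refl

add-upper : (x y : Tm Γ 𝟏) (n : Tm Γ O) → Δ ⊩
  pos · (x +ᵣ y) · n ∔ (neg · x · n ∔ neg · y · n)
  ≤₀ neg · (x +ᵣ y) · n ∔ (pos · x · n ∔ pos · y · n) ∔ num 2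
add-upper {Γ = Γ₀} = spec₃ (∀I (∀I (cut
  (⊃E₂ (spec₂ norm-upper (pos∔pos v₁ v₀) (neg∔neg v₁ v₀))
    (∀I (sum-low v₂ v₁ v₀)) (∀I (sum-high v₂ v₁ v₀)))
  (∀I (lin-≤ ε 1 (x₀ ⊕ (x₄ ⊕ x₅)) (x₁ ⊕ (x₆ ⊕ x₇) ⊕ lit 2)
    ((1 , le≤ (x₂ ⊕ x₈) (x₃ ⊕ x₉ ⊕ lit 2) (∀E h₀ v₀))
      ∷ (1 , eq≤ x₀ x₂ (conv-in (pos · v₀ · v₁) (v₂ +ᵣ v₁) (norm · p · q) refl))
      ∷ (1 , eq≥ x₁ x₃ (conv-in (neg · v₀ · v₁) (v₂ +ᵣ v₁) (norm · p · q) refl))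
      ∷ (1 , eq≥ x₈ (x₄ ⊕ x₅) (sum-at _ _ v₀))
      ∷ (1 , eq≤ x₉ (x₆ ⊕ x₇) (sum-at _ _ v₀)) ∷ []) refl)))))
  where
  p q : Tm (O ∷ 𝟏 ∷ 𝟏 ∷ Γ₀) 𝟏
  p = pos∔pos v₂ v₁
  q = neg∔neg v₂ v₁
  ε : Env (O ∷ 𝟏 ∷ 𝟏 ∷ Γ₀) 10
  ε = pos · (v₂ +ᵣ v₁) · v₀ ∷ neg · (v₂ +ᵣ v₁) · v₀ ∷ pos · (norm · p · q) · v₀
    ∷ neg · (norm · p · q) · v₀
    ∷ neg · v₂ · v₀ ∷ neg · v₁ · v₀ ∷ pos · v₂ · v₀ ∷ pos · v₁ · v₀ ∷ q · v₀ ∷ p · v₀ ∷ []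

-- Zero and the nonnegativity of the distance

0ᵣ : Tm Γ 𝟏
0ᵣ = natᵣ · num 0

-- All digits of `natᵣ` are 0, coded as 1, so `pos` and `neg` follow the same recursion.
0ᵣ-balanced : (n : Tm Γ O) → Δ ⊩ pos · 0ᵣ · n ≐ neg · 0ᵣ · n
0ᵣ-balanced = spec₁ (ind (pos · 0ᵣ · v₀ ≐ neg · 0ᵣ · v₀) (conv _ _ refl)
  (lin-= (pos · 0ᵣ · v₀ ∷ pos · 0ᵣ · 𝐬· v₀ ∷ neg · 0ᵣ · v₀ ∷ neg · 0ᵣ · 𝐬· v₀
      ∷ min₀ · (0ᵣ · 𝐬· (𝐬· v₀)) · num 2 ∷ [])
    x₁ x₃
    ((1 , equation x₁ (2 ⊛ x₀ ⊕ x₄) (pos-suc _ _))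
      ∷ (1 , equation (sc (2 ⊛ x₂)) x₃ (≐-sym (neg-suc _ _)))
      ∷ (1 , equation x₄ (lit 1) (conv _ (num 1) refl)) ∷ (2 , equation x₀ x₂ h₀) ∷ []) refl refl))

-- The precision-n instance of x ≤ᵣ y.
LeAt : Tm Γ 𝟏 → Tm Γ 𝟏 → Tm Γ O → Fm Γ
LeAt x y n = pos · x · n ∔ neg · y · n ≤₀ pos · y · n ∔ neg · x · n ∔ num 2

-- A negative value of d(x,y) is visible at some precision n.  At precision
-- n + 1 it contradicts 0 = d(x,x) ≤ d(x,y) + d(y,x) and d(y,x) ≤ d(x,y).
dist-nonneg : (x y : Tm Γ X) (n : Tm Γ O) → Δ ⊩ LeAt 0ᵣ (dist x y) n
dist-nonneg {Γ = Γ₀} = spec₃ (∀I (∀I (∀I (lin-≤ ε 4 (x₁₃ ⊕ x₁₁) (x₁₀ ⊕ x₁₂ ⊕ lit 2)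
  -- Let D be the partial sum of d(x,y) at precision n + 1. Reflexivity, triangle inequality,
  -- addition and symmetry lose 2 each, so 0 ≤ 2D + 8 and D ≥ -4. A failure at precision n means a
  -- partial sum of at most -3 there, hence D ≤ 2·(-3) + 1 = -5. At precision n itself, -3 would not
  -- contradict the bound -4.
  ((4 , eq≤ x₁₃ x₁₂ (0ᵣ-balanced v₀)) ∷ (1 , eq≥ x₀ x₁ (0ᵣ-balanced m))
    ∷ (1 , le≤ (x₀ ⊕ x₃) (x₂ ⊕ x₁ ⊕ lit 2) (∀E (∧E₂ (∀E (ax d-refl) v₂)) m))
    ∷ (1 , le≤ (x₂ ⊕ x₅) (x₄ ⊕ x₃ ⊕ lit 2) (∀E (∀E (∀E (∀E (ax d-tri) v₂) v₁) v₂) m))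
    ∷ (1 , le≤ (x₄ ⊕ (x₇ ⊕ x₉)) (x₅ ⊕ (x₆ ⊕ x₈) ⊕ lit 2) (add-upper (dist v₂ v₁) (dist v₁ v₂) m))
    ∷ (1 , le≤ (x₈ ⊕ x₇) (x₆ ⊕ x₉ ⊕ lit 2) (∀E (∧E₁ (∀E (∀E (ax d-sym) v₁) v₂)) m))
    ∷ (2 , le≤ x₆ (2 ⊛ x₁₀ ⊕ lit 2) (pos-suc-≤ _ v₀))
    ∷ (2 , eq≥ x₇ (sc (2 ⊛ x₁₁)) (neg-suc _ v₀)) ∷ []) refl))))
  where
  m : Tm (O ∷ X ∷ X ∷ Γ₀) O
  m = 𝐬· v₀
  ε : Env (O ∷ X ∷ X ∷ Γ₀) 14
  ε = pos · 0ᵣ · m ∷ neg · 0ᵣ · m ∷ pos · dist v₂ v₂ · m ∷ neg · dist v₂ v₂ · m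
    ∷ pos · (dist v₂ v₁ +ᵣ dist v₁ v₂) · m ∷ neg · (dist v₂ v₁ +ᵣ dist v₁ v₂) · m
    ∷ pos · dist v₂ v₁ · m ∷ neg · dist v₂ v₁ · m ∷ pos · dist v₁ v₂ · m ∷ neg · dist v₁ v₂ · m
    ∷ pos · dist v₂ v₁ · v₀ ∷ neg · dist v₂ v₁ · v₀ ∷ neg · 0ᵣ · v₀ ∷ pos · 0ᵣ · v₀ ∷ []

-- 1 / (k + 1) for large k

pow2-suc : (n : Tm Γ O) → Δ ⊩ pow2 · (𝐬· n ∔ num 3) ≐ pow2 · (n ∔ num 3) ∔ pow2 · (n ∔ num 3)
pow2-suc = spec₁ (∀I (conv (pow2 · (𝐬· v₀ ∔ num 3))
  (pow2 · (v₀ ∔ num 3) ∔ pow2 · (v₀ ∔ num 3)) refl))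

pow2-mono-+ : (j e : Tm Γ O) → Δ ⊩ pow2 · (j ∔ num 3) ≤₀ pow2 · (j ∔ e ∔ num 3)
pow2-mono-+ = spec₂ (∀I (ind (pow2 · (v₁ ∔ num 3) ≤₀ pow2 · (v₁ ∔ v₀ ∔ num 3))
  (lin-≤ (pow2 · (v₀ ∔ num 3) ∷ pow2 · (v₀ ∔ num 0 ∔ num 3) ∷ []) 1 x₀ x₁
    ((1 , eq≤ x₀ x₁ (conv _ _ refl)) ∷ []) refl)
  (lin-≤ (pow2 · (v₁ ∔ num 3) ∷ pow2 · (v₁ ∔ v₀ ∔ num 3) ∷ pow2 · (v₁ ∔ 𝐬· v₀ ∔ num 3) ∷ []) 1 x₀ x₂
    ((1 , le≤ x₀ x₁ h₀) ∷ (1 , eq≥ x₂ (x₁ ⊕ x₁)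
      (conv (pow2 · (v₁ ∔ 𝐬· v₀ ∔ num 3))
        (pow2 · (v₁ ∔ v₀ ∔ num 3) ∔ pow2 · (v₁ ∔ v₀ ∔ num 3)) refl)) ∷ []) refl)))

pow2-mono : (j n : Tm Γ O) → Δ ⊩ j ≤₀ n → Δ ⊩ pow2 · (j ∔ num 3) ≤₀ pow2 · (n ∔ num 3)
pow2-mono j n p = lin-≤ (pow2 · (j ∔ num 3) ∷ pow2 · (n ∔ num 3) ∷ pow2 · (j ∔ (n ∸̇ j) ∔ num 3)
  ∷ []) 1 x₀ x₁
  ((1 , le≤ x₀ x₂ (pow2-mono-+ j (n ∸̇ j)))
    ∷ (1 , eq≥ x₁ x₂ (≐-cong (pow2 · (v₀ ∔ num 3)) (proj₂ (≤₀⇒Leq p)))) ∷ []) refl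

quot-small : (k m : Tm Γ O) → Δ ⊩ m ≤₀ k → Δ ⊩ quot · m · k ≐ num 0
quot-small {Γ = Γ₀} k m = ⊃E (spec₂ (∀I (ind (v₀ ≤₀ v₁ ⊃ quot · v₀ · v₁ ≐ num 0)
  (⊃I (conv _ _ refl))
  -- The quotient increases only if `big` is at most the new dividend. But `big` is at least k + 1,
  -- and the dividend is at most k.
  (⊃I (∨E (le-cases big (𝐬· v₀))
    (lin-⊥ (v₁ ∷ v₀ ∷ big ∷ 𝐬· v₁ ∗ quot · v₀ · v₁ ∷ [])
      ((1 , le≤ (sc x₁) x₀ h₁) ∷ (1 , le≤ x₂ (sc x₁) (∧E₁ h₀))
        ∷ (1 , eq≥ x₂ (x₃ ⊕ sc x₀) (conv _ _ refl)) ∷ []) refl)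
    (conv (quot · 𝐬· v₀ · v₁) (quot · v₀ · v₁ ∔ le · big · 𝐬· v₀) refl
      ⨾ +-cong (⊃E h₂ (lin-≤ (v₁ ∷ v₀ ∷ []) 1 x₁ x₀ ((1 , le≤ (sc x₁) x₀ h₁) ∷ []) refl)) (∧E₂ h₀)
      ⨾ +-zero _))))) k m)
  where
  big : Tm (O ∷ O ∷ Γ₀) O
  big = 𝐬· v₁ ∗ 𝐬· (quot · v₀ · v₁)

-- invᵣ · k is norm of these two sequences.
inv⁺ : Tm Γ O → Tm Γ 𝟏
inv⁺ k = ƛ quot · (pow2 · v₀) · (k ↑)

inv⁻ : Tm Γ 𝟏
inv⁻ = ƛ num 0

inv⁺-small : {Δ : List (Fm (O ∷ O ∷ Γ))} → Δ ⊩ pow2 · (v₀ ∔ num 3) ≤₀ v₁ →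
  Δ ⊩ inv⁺ v₁ · (v₀ ∔ num 3) ≐ num 0
inv⁺-small p = conv (inv⁺ v₁ · (v₀ ∔ num 3)) (quot · (pow2 · (v₀ ∔ num 3)) · v₁) refl
  ⨾ quot-small _ _ p

digit≐1 : (a c : Tm Γ O) → Δ ⊩ a ≐ c → Δ ⊩ digit · a · c ≐ num 1
digit≐1 a c p = ∨E (digit-cases a c)
  (lin-⊥ (a ∷ c ∷ []) ((1 , le≤ (x₁ ⊕ lit 4) x₀ (∧E₁ h₀)) ∷ (1 , eq≤ x₀ x₁ (wk p)) ∷ []) refl)
  (∨E h₀ (∧E₂ h₀)
    (lin-⊥ (a ∷ c ∷ []) ((1 , le≤ (sc (x₀ ⊕ lit 4)) x₁ (∧E₁ h₀))
      ∷ (1 , eq≥ x₀ x₁ (wk (wk p))) ∷ []) refl))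

-- The digit at n depends on Tₙ and on the approximation at n + 3, which is 0 as long as 2ⁿ⁺³ ≤ k.
-- If Tₙ = 0 too, the quantity compared with ±4 vanishes and the digit is 0, coded as 1.
inv-digit : {Δ : List (Fm (O ∷ O ∷ Γ))} →
  Δ ⊩ pow2 · (v₀ ∔ num 3) ≤₀ v₁ → Δ ⊩ T⁺ · inv⁺ v₁ · inv⁻ · v₀ ≐ T⁻ · inv⁻ · v₀ →
  Δ ⊩ digits · inv⁺ v₁ · inv⁻ · v₀ ≐ num 1
inv-digit p e = digits-def _ _ _ ⨾ digit≐1 _ _
  (+-cong (inv⁺-small p ⨾ conv (num 0) (inv⁻ · (v₀ ∔ num 3)) refl) (*-cong (num 8) (≐-sym e)))

inv-T : {Δ : List (Fm (O ∷ Γ))} →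
  Δ ⊩ ∀̇[ O ] (pow2 · (v₀ ∔ num 3) ≤₀ v₁ ⊃ T⁺ · inv⁺ v₁ · inv⁻ · v₀ ≐ T⁻ · inv⁻ · v₀)
inv-T {Γ} = ind (pow2 · (v₀ ∔ num 3) ≤₀ v₁ ⊃ T⁺ · inv⁺ v₁ · inv⁻ · v₀ ≐ T⁻ · inv⁻ · v₀)
  (⊃I (T⁺-zero _ _
    ⨾ conv (inv⁺ v₀ · num 0) (quot · num 1 · v₀) refl
    ⨾ quot-small _ _ (lin-≤ (pow2 · (num 0 ∔ num 3) ∷ v₀ ∷ []) 1 (lit 1) x₁
        ((1 , le≤ x₀ x₁ h₀) ∷ (1 , eq≥ x₀ (lit 8) (conv _ (num 8) refl)) ∷ []) refl)
    ⨾ ≐-sym (T⁻-zero (inv⁺ v₀) _ ⨾ conv _ (num 0) refl)))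
  (⊃I (cut
    (lin-≤ (pow2 · (v₀ ∔ num 3) ∷ pow2 · (𝐬· v₀ ∔ num 3) ∷ v₁ ∷ []) 1 x₀ x₂
      ((1 , eq≥ x₁ (x₀ ⊕ x₀) (pow2-suc v₀)) ∷ (1 , le≤ x₁ x₂ h₀) ∷ []) refl)
    (cut (⊃E h₂ h₀)
      (lin-= (T⁺ · inv⁺ v₁ · inv⁻ · v₀ ∷ T⁺ · inv⁺ v₁ · inv⁻ · 𝐬· v₀ ∷ T⁻ · inv⁻ · v₀
        ∷ T⁻ · inv⁻ · 𝐬· v₀
          ∷ digits · inv⁺ v₁ · inv⁻ · v₀ ∷ [])
        x₁ x₃
        ((1 , equation x₁ (2 ⊛ (x₀ ⊕ x₄)) (T⁺-suc _ _ _))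
          ∷ (1 , equation (2 ⊛ sc x₂) x₃ (≐-sym (T⁻-suc (inv⁺ v₁) _ _)))
          ∷ (2 , equation x₄ (lit 1) (inv-digit h₁ h₀))
          ∷ (2 , equation x₀ x₂ h₀) ∷ []) refl refl))))

inv-balanced : (k n : Tm Γ O) → Δ ⊩ pow2 · (n ∔ num 3) ≤₀ k →
  Δ ⊩ pos · (invᵣ · k) · n ≐ neg · (invᵣ · k) · n
inv-balanced {Γ = Γ₀} k n = ⊃E (spec₂ (∀I (∀I (⊃I (cut
  (⊃E (spec₂ (∀I inv-T) v₁ v₀) h₀)
  (lin-= ε x₀ x₁
    ((1 , equation x₀ x₂ (conv-in (pos · v₀ · v₁) (invᵣ · v₁) (norm · inv⁺ v₁ · inv⁻) refl))
      ∷ (1 , equation x₃ x₁ (conv-in (neg · v₀ · v₁) (norm · inv⁺ v₁ · inv⁻) (invᵣ · v₁) refl))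
      ∷ (1 , equation (x₂ ⊕ x₅ ⊕ lit 1) (x₃ ⊕ x₄ ⊕ x₆) (norm-partial _ _ _))
      ∷ (1 , equation x₆ (lit 1) (inv-digit h₁ h₀))
      ∷ (1 , equation x₄ x₅ h₀) ∷ []) refl refl))))) k n)
  where
  ε : Env (O ∷ O ∷ Γ₀) 7
  ε = pos · (invᵣ · v₁) · v₀ ∷ neg · (invᵣ · v₁) · v₀ ∷ pos · (norm · inv⁺ v₁ · inv⁻) · v₀
    ∷ neg · (norm · inv⁺ v₁ · inv⁻) · v₀
    ∷ T⁺ · inv⁺ v₁ · inv⁻ · v₀ ∷ T⁻ · inv⁻ · v₀ ∷ digits · inv⁺ v₁ · inv⁻ · v₀ ∷ []

-- Finite conjunctions

-- For a variable number of conjuncts, renaming and substitution do not compute through `⋀`. Here F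
-- stands for a whole stack of them, as piled up by nested quantifier rules and assembled with
-- `_∘D_`.
record Distributes (F : Fm Γ → Fm Θ) : Set where
  constructor distributes
  field
    over-⋀ : (n : ℕ) (A : Fin n → Fm Γ) → F (⋀ n A) ≡ ⋀ n (λ i → F (A i))

open Distributes

renD : (r : Γ ⊆ Θ) → Distributes (renF r)
renD {Γ} r = distributes go
  where
  go : (n : ℕ) (A : Fin n → Fm Γ) → renF r (⋀ n A) ≡ ⋀ n (λ i → renF r (A i))
  go zero    A = refl
  go (suc n) A = cong (renF r (A zero) ∧̇_) (go n (λ i → A (suc i)))

subD : (f : Sub Γ Θ) → Distributes (subF f)
subD {Γ} f = distributes go
  where
  go : (n : ℕ) (A : Fin n → Fm Γ) → subF f (⋀ n A) ≡ ⋀ n (λ i → subF f (A i))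
  go zero    A = refl
  go (suc n) A = cong (subF f (A zero) ∧̇_) (go n (λ i → A (suc i)))

infixr 9 _∘D_
_∘D_ : {F : Fm Θ → Fm Ξ} {G : Fm Γ → Fm Θ} → Distributes F → Distributes G →
  Distributes (λ A → F (G A))
_∘D_ {F = F} D E = distributes λ n A → trans (cong F (over-⋀ E n A)) (over-⋀ D n _)

⋀I : (n : ℕ) {A : Fin n → Fm Γ} → (∀ i → Δ ⊩ A i) → Δ ⊩ ⋀ n A
⋀I zero    p = ⊃I h₀
⋀I (suc n) p = ∧I (p zero) (⋀I n (λ i → p (suc i)))

⋀E : (n : ℕ) {A : Fin n → Fm Γ} → Δ ⊩ ⋀ n A → ∀ i → Δ ⊩ A i
⋀E (suc n) p zero    = ∧E₁ p
⋀E (suc n) p (suc i) = ⋀E n (∧E₂ p) i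

⋀I-via : {F : Fm Γ → Fm Θ} → Distributes F → (n : ℕ) {A : Fin n → Fm Γ} {Δ : List (Fm Θ)} →
         (∀ i → Δ ⊩ F (A i)) → Δ ⊩ F (⋀ n A)
⋀I-via D n {A} p = cast (sym (over-⋀ D n A)) (⋀I n p)

⋀E-via : {F : Fm Γ → Fm Θ} → Distributes F → (n : ℕ) {A : Fin n → Fm Γ} {Δ : List (Fm Θ)} →
         Δ ⊩ F (⋀ n A) → ∀ i → Δ ⊩ F (A i)
⋀E-via D n {A} p = ⋀E n (cast (over-⋀ D n A) p)

Bounded-⋀ : (n : ℕ) {A : Fin n → Fm Γ} → (∀ i → Bounded (A i)) → Bounded (⋀ n A)
Bounded-⋀ zero    b = imp bot bot
Bounded-⋀ (suc n) b = and (b zero) (Bounded-⋀ n (λ i → b (suc i)))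

-- Monotone formulas and common bounds

infix 10 _⟨_,_⟩
_⟨_,_⟩ : Fm (σ ∷ Γ) → Γ ⊆ Θ → Tm Θ σ → Fm Θ
A ⟨ r , t ⟩ = subF ((λ x → var (r x)) ▹ t) A

-- Quantifying over renamings makes the property available under further binders, such as the two
-- existentials opened in `∃-∧`.
Monotone : Fm (O ∷ Γ) → Set
Monotone {Γ} A = ∀ {Θ} {Δ : List (Fm Θ)} (r : Γ ⊆ Θ) (s t : Tm Θ O) →
  Δ ⊩ s ≤₀ t → Δ ⊩ A ⟨ r , s ⟩ → Δ ⊩ A ⟨ r , t ⟩

Monotone-∧ : {A B : Fm (O ∷ Γ)} → Monotone A → Monotone B → Monotone (A ∧̇ B)
Monotone-∧ a b r s t l p = ∧I (a r s t l (∧E₁ p)) (b r s t l (∧E₂ p))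

Monotone-⋀ : (n : ℕ) {A : Fin n → Fm (O ∷ Γ)} → (∀ i → Monotone (A i)) → Monotone (⋀ n A)
Monotone-⋀ zero    m r s t l p = p
Monotone-⋀ (suc n) {A} m = Monotone-∧ {A = A zero} (m zero) (Monotone-⋀ n (λ i → m (suc i)))

≤-trans : {r s t : Tm Γ O} → Δ ⊩ r ≤₀ s → Δ ⊩ s ≤₀ t → Δ ⊩ r ≤₀ t
≤-trans {r = r} {s} {t} p q =
  lin-≤ (r ∷ s ∷ t ∷ []) 1 x₀ x₂ ((1 , le≤ x₀ x₁ p) ∷ (1 , le≤ x₁ x₂ q) ∷ []) refl

-- The matrix does not mention the bound, so its instances for two bounds coincide; only the guard
-- has to be adjusted in the two monotonicity lemmas.
skip-bound : (A : Fm (O ∷ Γ)) (r : Γ ⊆ Θ) (s : Tm Θ σ) →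
  subF (lift ((λ x → var (r x)) ▹ s)) (renF (∷⁺ʳ O there) A) ≡ subF (lift (λ x → var (r x))) A
skip-bound {Γ} A r s = trans (subF-renF _ _ A) (subF-cong e A)
  where
  e : (λ {τ} (x : τ ∈ O ∷ Γ) → lift ((λ x → var (r x)) ▹ s)
    (∷⁺ʳ O there x)) ≗ˢ lift (λ x → var (r x))
  e (here refl) = refl
  e (there x)   = refl

Monotone-∃≤ : (A : Fm (O ∷ Γ)) → Monotone (∃̇≤ v₀ (renF (∷⁺ʳ O there) A))
Monotone-∃≤ A r s t l p = cut l (∃E (wk p)
  (rebind (v₀ ≤₀ t ↑ ∧̇ _)
    (∧I (≤-trans (∧E₁ h₀) h₁) (cast (trans (skip-bound A r s) (sym (skip-bound A r t))) (∧E₂ h₀)))))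

Monotone-∀≥ : (A : Fm (O ∷ Γ)) → Monotone (∀̇[ O ] (v₁ ≤₀ v₀ ⊃ renF (∷⁺ʳ O there) A))
Monotone-∀≥ A r s t l p =
  cut l (cut (wk p) (∀I (⊃I (cast (trans (skip-bound A r s) (sym (skip-bound A r t)))
    (⊃E (wk (unbind (s ↑ ≤₀ v₀ ⊃ _) h₀)) (≤-trans h₂ h₀))))))

∃-∧ : {A B : Fm (O ∷ Γ)} → Monotone A → Monotone B →
      Δ ⊩ ∃̇[ O ] A → Δ ⊩ ∃̇[ O ] B → Δ ⊩ ∃̇[ O ] (A ∧̇ B)
-- The sum of the two witnesses serves as their common upper bound.
∃-∧ {Γ = Γ} {A = A} {B} a b p q = cut q (∃E (wk p) (∃E h₁ (∃I (v₁ ∔ v₀) (∧I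
  (cast (sym (both A)) (a r v₁ (v₁ ∔ v₀) (lin-≤ (v₁ ∷ v₀ ∷ []) 1 x₀ (x₀ ⊕ x₁) [] refl)
    (cast (first A) h₁)))
  (cast (sym (both B)) (b r v₀ (v₁ ∔ v₀) (lin-≤ (v₁ ∷ v₀ ∷ []) 1 x₁ (x₀ ⊕ x₁) [] refl)
    (cast (second B) h₀)))))))
  where
  r : Γ ⊆ O ∷ O ∷ Γ
  r x = there (there x)
  both : (A : Fm (O ∷ Γ)) → renF (∷⁺ʳ O there)
    (renF (∷⁺ʳ O there) A) [ v₁ ∔ v₀ ] ≡ A ⟨ r , v₁ ∔ v₀ ⟩
  both A = trans (subF-renF _ _ _) (trans (subF-renF _ _ A) (subF-cong e A))
    where
    e : (λ {τ} (x : τ ∈ O ∷ Γ) → inst (v₁ ∔ v₀)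
      (∷⁺ʳ O there (∷⁺ʳ O there x))) ≗ˢ ((λ x → var (r x)) ▹ (v₁ ∔ v₀))
    e (here refl) = refl
    e (there x)   = refl
  first : (A : Fm (O ∷ Γ)) → weaken A ≡ A ⟨ r , v₁ ⟩
  first A = trans (renF-as-subF there A) (subF-cong e A)
    where
    e : (λ {τ} (x : τ ∈ O ∷ Γ) → var (there x)) ≗ˢ ((λ x → var (r x)) ▹ v₁)
    e (here refl) = refl
    e (there x)   = refl
  second : (A : Fm (O ∷ Γ)) → renF (∷⁺ʳ O there) A ≡ A ⟨ r , v₀ ⟩
  second A = trans (renF-as-subF _ A) (subF-cong e A)
    where
    e : (λ {τ} (x : τ ∈ O ∷ Γ) → var (∷⁺ʳ O there x)) ≗ˢ ((λ x → var (r x)) ▹ v₀)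
    e (here refl) = refl
    e (there x)   = refl

-- The index i lives outside the theory, so the bounds are merged by an induction outside the
-- theory.
common-bound : (n : ℕ) {A : Fin n → Fm (O ∷ Γ)} → (∀ i → Monotone (A i)) →
               (∀ i → Δ ⊩ ∃̇[ O ] A i) → Δ ⊩ ∃̇[ O ] ⋀ n A
common-bound zero    m p = ∃I (num 0) (⊃I h₀)
common-bound (suc n) {A} m p =
  ∃-∧ {A = A zero} (m zero) (Monotone-⋀ n (λ i → m (suc i))) (p zero)
    (common-bound n (λ i → m (suc i)) (λ i → p (suc i)))

-- The collection argument

v₃ : Tm (ρ ∷ σ ∷ τ ∷ O ∷ Γ) O
v₃ = v₂ ↑

LtAt : Tm Γ 𝟏 → Tm Γ 𝟏 → Tm Γ O → Fm Γ
LtAt x y n = 𝐬· (pos · x · n ∔ neg · y · n ∔ num 2) ≤₀ pos · y · n ∔ neg · x · n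

module Proof (ℓ : ℕ) where

  open Maps ℓ

  -- The variables k and x of the conclusion
  Γ₂ : Cx
  Γ₂ = X ∷ O ∷ Data ℓ

  Fixed : Fin ℓ → Fm (X ∷ Γ₂)
  Fixed i = U i ↑ ↑ ↑ · v₀ =ₓ v₀

  Lt : Fin ℓ → Fm (O ∷ X ∷ Γ₂)
  Lt i = LtAt (φ i ↑ ↑ ↑ ↑ · v₂ · v₂) (φ i ↑ ↑ ↑ ↑ · v₂ · v₁ +ᵣ invᵣ · v₃) v₀

  Minimal : Fm (X ∷ Γ₂)
  Minimal = v₀ ∈Fix (λ i → U i ↑ ↑ ↑) ⊃ AlmostMinimal (λ i → φ i ↑ ↑ ↑) v₁ v₀ v₂

  FixedAt : Fin ℓ → Fm (O ∷ X ∷ Γ₂)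
  FixedAt i = LeAt (dist (U i ↑ ↑ ↑ ↑ · v₁) v₁) 0ᵣ v₀

  -- A bounded existential is monotone in its bound by form alone, so one n can serve all i without
  -- any comparison of partial sums at different precisions.
  LtBelow : Fin ℓ → Fm (O ∷ X ∷ Γ₂)
  LtBelow i = ∃̇≤ v₀ (renF (∷⁺ʳ O there) (Lt i))

  -- Σ-formulas carry one unbounded quantifier, which is a dummy here.
  Matrix : Fm (O ∷ O ∷ X ∷ Γ₂)
  Matrix = ⋀ ℓ (λ i → weaken (FixedAt i)) ⊃ ⋀ ℓ (λ i → weaken (LtBelow i))

  Matrix-Σ : Σ-Formula (∃̇[ O ] Matrix)
  Matrix-Σ = ex (imp (Bounded-⋀ ℓ (λ i → atom _ _)) (Bounded-⋀ ℓ (λ i → ex≤ v₁ (atom _ _))))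

  fixed : {Δ : List (Fm (X ∷ Γ₂))} → Δ ⊩ ∀̇[ O ] ⋀ ℓ FixedAt → Δ ⊩ ⋀ ℓ Fixed
  fixed p = ⋀I ℓ (λ i → ∧I
    (cut p (∀I (⋀E ℓ (unbind (⋀ ℓ FixedAt) h₀) i)))
    (∀I (dist-nonneg (U i ↑ ↑ ↑ ↑ · v₁) v₁ v₀)))

  -- If y lies in F, then n is a common bound for the precisions witnessing the strict inequalities.
  -- Otherwise n is a precision at which the premise of `Matrix` fails, and the implication is
  -- vacuous.
  local-bound : Minimal ∷ Δ ⊩ ∃̇[ O ] ∃̇[ O ] Matrix
  local-bound = ∨E (excluded-middle {A = ∀̇[ O ] ⋀ ℓ FixedAt})
    (∃E (common-bound ℓ {A = LtBelow} (λ i → Monotone-∃≤ (Lt i))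
          (λ i → ∃E (⋀E ℓ (⊃E h₁ (fixed h₀)) i)
            (∃I v₀ (∃I v₀ (∧I (lin-≤ (v₀ ∷ []) 1 x₀ x₀ [] refl) h₀)))))
      -- The value 0 instantiates the dummy quantifier.
      (rebind (∃̇[ O ] Matrix) (∃I (num 0) (⊃I
        (⋀I-via (subD _) ℓ (λ i → ⋀E ℓ h₁ i))))))
    (∃E (¬∀⇒∃¬ (⋀ ℓ FixedAt) h₀)
      (rebind (∃̇[ O ] Matrix) (∃I (num 0) (⊃I (⊥E
        (⊃E h₁ (⋀I ℓ (λ i → ⋀E-via (subD _) ℓ h₀ i))))))))

  uniform-bound : (∀̇[ X ] Minimal) ∷ Δ ⊩ ∃̇[ O ] ∀̇[ X ] ∃̇≤ v₁ (weaken₂ (∃̇[ O ] Matrix))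
  uniform-bound = ⊃E (axiom (collectionX Matrix-Σ)) (∀I (cut (unbind Minimal h₀) local-bound))

  -- Here v₁ is the start of a tail of u, and v₂ the bound from uniform-bound.
  Close CloseFrom : Fin ℓ → Fm (O ∷ O ∷ Γ₂)
  Close i = dist (U i ↑ ↑ ↑ ↑ · (u ↑ ↑ ↑ ↑ · v₀)) (u ↑ ↑ ↑ ↑ · v₀) ≤ᵣ invᵣ · (pow2 · (v₁ ∔ num 3))
  CloseFrom i = ∀̇[ O ] (v₁ ≤₀ v₀ ⊃ renF (∷⁺ʳ O there) (Close i))

  -- At precision n both right-hand sides have partial sum exactly 0, so the two comparisons agree.
  -- A single index 2ᵐ⁺³ thus covers all precisions n ≤ m.
  close-at : {x : Tm Γ 𝟏} {n m : Tm Γ O} → Δ ⊩ n ≤₀ m →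
    Δ ⊩ LeAt x (invᵣ · (pow2 · (m ∔ num 3))) n → Δ ⊩ LeAt x 0ᵣ n
  close-at {x = x} {n} {m} p q = lin-≤
    (pos · x · n ∷ neg · x · n ∷ pos · inv · n ∷ neg · inv · n ∷ pos · 0ᵣ · n ∷ neg · 0ᵣ · n ∷ []) 1
    (x₀ ⊕ x₅) (x₄ ⊕ x₁ ⊕ lit 2)
    ((1 , le≤ (x₀ ⊕ x₃) (x₂ ⊕ x₁ ⊕ lit 2) q) ∷ (1 , eq≤ x₂ x₃ (inv-balanced _ n (pow2-mono n m p)))
      ∷ (1 , eq≥ x₄ x₅ (0ᵣ-balanced n)) ∷ []) refl
    where inv = invᵣ · (pow2 · (m ∔ num 3))

  Asymptotic : Fm (Data ℓ)
  Asymptotic = ⋀ ℓ (λ i → AsymptoticallyFixed (U i) u)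

  Tail : Fm (O ∷ O ∷ Γ₂)
  Tail = v₁ ≤₀ v₀ ⊃ AlmostMinimal (λ i → φ i ↑ ↑ ↑ ↑) v₂ (u ↑ ↑ ↑ ↑ · v₀) (v₂ ↑)

  eventually : (∀̇[ X ] Minimal) ∷ weaken (weaken Asymptotic) ∷ Δ ⊩ ∃̇[ O ] ∀̇[ O ] Tail
  eventually = ∃E uniform-bound
    (∃E (common-bound ℓ {A = CloseFrom} (λ i → Monotone-∀≥ (Close i))
          -- The precision that collection later returns depends on the element of u, and only its
          -- bound N is known here. The choice k = 2 to the power N + 3 is good for all of them.
          (λ i → ∀E (⋀E-via (renD _ ∘D renD _ ∘D renD _) ℓ h₂ i) (pow2 · (v₀ ∔ num 3))))
      (∃I v₀ (∀I (⊃I (⋀I-via (subD _ ∘D renD _ ∘D renD _) ℓ (λ i →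
        ∃E (∀E h₂ (u ↑ ↑ ↑ ↑ ↑ · v₀))
          (∃E (∧E₂ h₀)
            (∃E (⋀E-via (subD _ ∘D renD _ ∘D renD _ ∘D renD _) ℓ (⊃E h₀
                (⋀I-via (subD _ ∘D renD _ ∘D renD _ ∘D renD _) ℓ (λ i →
                  close-at (∧E₁ h₁)
                    (∀E (⊃E (∀E (⋀E-via (renD _ ∘D renD _ ∘D renD _) ℓ h₃ i) v₂) h₂) v₁)))) i)
              -- The bound on the precision has done its work: the strict inequality asks only for
              -- some precision.
              (∃I v₀ (∧E₂ h₀))))))))))

  theorem : [] ⊩ Asymptotic ⊃
       (∀̇[ O ] ∃̇[ X ] (v₀ ∈Fix (λ i → U i ↑ ↑) ∧̇ (∀̇[ X ] Minimal))) ⊃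
       (∀̇[ O ] ∃̇[ X ] (v₀ ∈Fix (λ i → U i ↑ ↑) ∧̇ (∃̇[ O ] ∀̇[ O ] Tail)))
  theorem = ⊃I (⊃I (∀I (∃E
    (unbind (∃̇[ X ] (v₀ ∈Fix (λ i → U i ↑ ↑) ∧̇ (∀̇[ X ] Minimal))) h₀)
    (rebind (v₀ ∈Fix (λ i → U i ↑ ↑) ∧̇ (∃̇[ O ] ∀̇[ O ] Tail))
      (∧I (∧E₁ h₀) (cut h₂ (cut (∧E₂ h₁) eventually)))))))

proposition6p1 : (ℓ : ℕ) → .{{_ : NonZero ℓ}} →
    let open Maps ℓ in
    𝒯ₘ⁺ ⊢ closure
    (⋀ ℓ (λ i → AsymptoticallyFixed (U i) u) ⊃
    (∀̇[ O ] ∃̇[ X ] (v₀ ∈Fix (λ i → U i ↑ ↑) ∧̇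
    (∀̇[ X ] (v₀ ∈Fix (λ i → U i ↑ ↑ ↑) ⊃
    AlmostMinimal (λ i → φ i ↑ ↑ ↑) v₁ v₀ v₂)))) ⊃
    (∀̇[ O ] ∃̇[ X ] (v₀ ∈Fix (λ i → U i ↑ ↑) ∧̇
    (∃̇[ O ] ∀̇[ O ] (v₁ ≤₀ v₀ ⊃
    AlmostMinimal (λ i → φ i ↑ ↑ ↑ ↑) v₂ (u ↑ ↑ ↑ ↑ · v₀) (v₂ ↑))))))
proposition6p1 ℓ = closureI (Data ℓ) (Proof.theorem ℓ)
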